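{- For integers $n, \alpha, \beta$ with $n$ even, let $G^{(7)}(n;\alpha,\beta)$ be the graph with vertex set $\{a_j, b_j, c_j, d_j, e_j, f_j, g_j : j \in \mathbb{Z}_n\}$ and edges, for every $j \in \mathbb{Z}_n$: $a_j a_{j+\alpha}$, $a_j b_j$, $b_j b_{j+n/2}$, $b_j c_j$, $c_j d_j$, $c_j e_j$, $d_j d_{j+n/2}$, $e_j e_{j+n/2}$, $d_j f_j$, $e_j f_j$, $f_j g_j$, $g_j g_{j+\beta}$. Then $G^{(7)}(n;\alpha,\beta)$ is a nut graph whenever one of the following holds: (i) $n \ge 4$, $4 \mid n$ and $\alpha = \beta = 1$; (ii) $n \ge 6$, $n \equiv 2 \pmod 4$ and $\alpha = \beta = 2$.
   Context: A nut graph is a simple graph with at least two vertices whose adjacency matrix has a one-dimensional null space spanned by a vector with no zero entries.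
   Formalization: The null space of the adjacency matrix is taken over ℚ rather than over the reals. -}

module Defs where

open import Data.Nat using (ℕ; zero; suc; _≤_; NonZero; _/_; _%_)
open import Data.Nat.Properties using () renaming (_≟_ to _≟ℕ_)
open import Data.Fin using (Fin; zero; suc; toℕ; remQuot)
open import Data.Fin.Properties using () renaming (_≟_ to _≟F_)
open import Data.Bool using (Bool; true; false; _∨_; if_then_else_)
open import Data.Product using (_×_; _,_; ∃; proj₁; proj₂)
open import Data.Rational using (ℚ; 0ℚ; 1ℚ; _+_; _*_)
open import Relation.Nullary using (¬_)
open import Relation.Nullary.Decidable using (⌊_⌋)
open import Relation.Binary.PropositionalEquality using (_≡_)
open import Function using (_∘_)

record Graph : Set where
  field
    N   : ℕ
    adj : Fin N → Fin N → Bool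
open Graph public

sumℚ : ∀ {N} → (Fin N → ℚ) → ℚ
sumℚ {zero}  f = 0ℚ
sumℚ {suc N} f = f zero + sumℚ (f ∘ suc)

adjMatrix : (G : Graph) → Fin (N G) → Fin (N G) → ℚ
adjMatrix G u v = if adj G u v then 1ℚ else 0ℚ

InNullSpace : (G : Graph) → (Fin (N G) → ℚ) → Set
InNullSpace G x = ∀ u → sumℚ (λ v → adjMatrix G u v * x v) ≡ 0ℚ

IsSimple : Graph → Set
IsSimple G = (∀ u v → adj G u v ≡ adj G v u) × (∀ u → adj G u u ≡ false)

IsNutGraph : Graph → Set
IsNutGraph G =
  IsSimple G × (2 ≤ N G) ×
  ∃ λ (x : Fin (N G) → ℚ) →
      InNullSpace G x
    × (∀ u → ¬ (x u ≡ 0ℚ))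
    × (∀ (y : Fin (N G) → ℚ) → InNullSpace G y → ∃ λ (c : ℚ) → ∀ u → y u ≡ c * x u)

shiftTo : (n : ℕ) .{{_ : NonZero n}} → ℕ → Fin n → Fin n → Bool
shiftTo n s j j' = ⌊ toℕ j' ≟ℕ (toℕ j Data.Nat.+ s) % n ⌋

sameIdx : ∀ {n} → Fin n → Fin n → Bool
sameIdx j j' = ⌊ j ≟F j' ⌋

-- Layers: 0=a, 1=b, 2=c, 3=d, 4=e, 5=f, 6=g.
-- Directed generating edge relation; the graph's adjacency is its symmetrisation.
genEdge : (n : ℕ) .{{_ : NonZero n}} → ℕ → ℕ → Fin 7 × Fin n → Fin 7 × Fin n → Bool
genEdge n α β (zero , j) (zero , j') = shiftTo n α j j'                                    -- a_j a_{j+α}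
genEdge n α β (zero , j) (suc zero , j') = sameIdx j j'                                    -- a_j b_j
genEdge n α β (suc zero , j) (suc zero , j') = shiftTo n (n / 2) j j'                      -- b_j b_{j+n/2}
genEdge n α β (suc zero , j) (suc (suc zero) , j') = sameIdx j j'                          -- b_j c_j
genEdge n α β (suc (suc zero) , j) (suc (suc (suc zero)) , j') = sameIdx j j'              -- c_j d_j
genEdge n α β (suc (suc zero) , j) (suc (suc (suc (suc zero))) , j') = sameIdx j j'        -- c_j e_j
genEdge n α β (suc (suc (suc zero)) , j) (suc (suc (suc zero)) , j') = shiftTo n (n / 2) j j'              -- d_j d_{j+n/2}
genEdge n α β (suc (suc (suc (suc zero))) , j) (suc (suc (suc (suc zero))) , j') = shiftTo n (n / 2) j j'  -- e_j e_{j+n/2}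
genEdge n α β (suc (suc (suc zero)) , j) (suc (suc (suc (suc (suc zero)))) , j') = sameIdx j j'            -- d_j f_j
genEdge n α β (suc (suc (suc (suc zero))) , j) (suc (suc (suc (suc (suc zero)))) , j') = sameIdx j j'      -- e_j f_j
genEdge n α β (suc (suc (suc (suc (suc zero)))) , j) (suc (suc (suc (suc (suc (suc zero))))) , j') = sameIdx j j'  -- f_j g_j
genEdge n α β (suc (suc (suc (suc (suc (suc zero))))) , j) (suc (suc (suc (suc (suc (suc zero))))) , j') = shiftTo n β j j'  -- g_j g_{j+β}
genEdge n α β _ _ = false

G7 : (n : ℕ) .{{_ : NonZero n}} → ℕ → ℕ → Graph
G7 n α β = record
  { N   = 7 Data.Nat.* n
  ; adj = λ u v → genEdge n α β (remQuot n u) (remQuot n v) ∨ genEdge n α β (remQuot n v) (remQuot n u)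
  }

-- A kernel vector of G⁽⁷⁾(n; s, s) is determined by its d-layer D: the equations at
-- the c-, d-, e-, f- and g-vertices force e = d and express the other layers through D,
-- and the equation at the a-vertices becomes 3·T(D∘ρ) + 2·T²D − 2·D = 0, where
-- T = shiftSum, (T f)(j) = f(j + s) + f(j − s), and ρ = opp is the shift j ↦ j + n/2.
-- On E = D + D∘ρ and O = D − D∘ρ this reads (2T − 1)(T + 2)E = 0 and
-- (2T + 1)(T − 2)O = 0. Over ℚ the equation W = ±2·T·W forces W = 0 (clearing
-- denominators, every value would be divisible by every power of 2), so (T + 2)E = 0
-- and (T − 2)O = 0: along the orbits of j ↦ j + s, E alternates and O is an arithmetic
-- progression, and periodicity leaves D = c·(−1)^j. Conversely D = (−1)^j is a
-- solution exactly when s + n/2 is odd, which both hypotheses guarantee, and the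
-- layers it generates are (−1)^j times ±1, ±2, ±3 or ±4, so nowhere zero.

module Submission where

open import Defs
open import Data.Nat using (ℕ; _≤_; _%_; NonZero)
open import Data.Nat.Divisibility using (_∣_; divides)
open import Data.Product using (_×_)
open import Data.Sum using (_⊎_)
open import Relation.Binary.PropositionalEquality using (_≡_)

open import Agda.Builtin.FromNat using (Number)
open import Agda.Builtin.FromNeg using (Negative)
open import Data.Bool using (Bool; true; false; _∨_; if_then_else_)
open import Data.Bool.Properties using (∨-comm)
open import Data.Empty using (⊥; ⊥-elim)
open import Data.Fin as Fin using (Fin; zero; suc; toℕ; _↑ˡ_; _↑ʳ_; combine; remQuot)
import Data.Fin.Properties as Fin
open import Data.Integer as ℤ using (ℤ; +_; -[1+_]; ∣_∣)
import Data.Integer.Properties as ℤ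
import Data.Integer.Divisibility.Signed as ℤ
import Data.Integer.Tactic.RingSolver as ℤ-Solver
open import Data.List using (_∷_; [])
open import Data.Nat as ℕ using (zero; suc; _/_; _∸_; z≤n; s≤s)
import Data.Nat.Properties as ℕ
import Data.Nat.Divisibility as ℕ
import Data.Nat.Literals as ℕ
open import Data.Nat.DivMod using (_mod_; m%n<n; %-distribˡ-+; m%n%n≡m%n; [m+n]%n≡m%n; m<n⇒m%n≡m; m≡m%n+[m/n]*n; [m+kn]%n≡m%n; m*n/n≡m)
open import Data.Product using (Σ; ∃; _,_; proj₁; proj₂; uncurry)
open import Data.Rational as ℚ using (ℚ; 0ℚ; 1ℚ; ½; _+_; _*_; -_; _-_; ↥_; ↧_; 1/_)
import Data.Rational.Properties as ℚ
open import Algebra.Properties.Group ℚ.+-0-group using (inverseˡ-unique; x∙y⁻¹≈ε⇒x≈y)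
open import Data.Rational.Literals using (fromℤ; number; negative)
import Data.Rational.Unnormalised as ℚᵘ
import Data.Rational.Unnormalised.Properties as ℚᵘ
open import Data.Sum using (inj₁; inj₂)
open import Data.Unit using (⊤; tt)
open import Function using (_∘_)
open import Level using (0ℓ)
open import Relation.Binary.PropositionalEquality
open import Relation.Nullary using (¬_; yes; no)
open import Relation.Nullary.Decidable using (dec⇒maybe)
open import Tactic.RingSolver using (solve-∀)
open import Tactic.RingSolver.Core.AlmostCommutativeRing using (AlmostCommutativeRing; fromCommutativeRing)

-- Numeric literals are overloaded (as in 2 * x : ℚ) only inside this block: with
-- fromNat in scope, a literal divisor such as the 2 in n / 2 no longer finds its
-- NonZero instance when an instance NonZero n is also in scope.
module _ where

  open import Agda.Builtin.FromNat using (fromNat)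

  instance
    ℕ-number : Number ℕ
    ℕ-number = ℕ.number
    ℚ-number : Number ℚ
    ℚ-number = number
    ℚ-negative : Negative ℚ
    ℚ-negative = negative
    ⊤-instance : ⊤
    ⊤-instance = tt

  ℚ-ring : AlmostCommutativeRing 0ℓ 0ℓ
  ℚ-ring = fromCommutativeRing ℚ.+-*-commutativeRing (λ q → dec⇒maybe (0ℚ ℚ.≟ q))

  fromℤ-+ : ∀ a b → fromℤ (a ℤ.+ b) ≡ fromℤ a + fromℤ b
  fromℤ-+ a b = ℚ.toℚᵘ-injective (ℚᵘ.≃-trans (ℚᵘ.*≡* cross) (ℚᵘ.≃-sym (ℚ.toℚᵘ-homo-+ (fromℤ a) (fromℤ b))))
    where
    cross : (a ℤ.+ b) ℤ.* + 1 ≡ (a ℤ.* + 1 ℤ.+ b ℤ.* + 1) ℤ.* + 1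
    cross = ℤ-Solver.solve (a ∷ b ∷ [])

  fromℤ-* : ∀ a b → fromℤ (a ℤ.* b) ≡ fromℤ a * fromℤ b
  fromℤ-* a b = ℚ.toℚᵘ-injective (ℚᵘ.≃-sym (ℚ.toℚᵘ-homo-* (fromℤ a) (fromℤ b)))

  fromℤ-injective : ∀ {a b} → fromℤ a ≡ fromℤ b → a ≡ b
  fromℤ-injective refl = refl

  *-↧≡↥ : ∀ q → q * fromℤ (↧ q) ≡ fromℤ (↥ q)
  *-↧≡↥ q@record{} =
    ℚ.toℚᵘ-injective (ℚᵘ.≃-trans (ℚ.toℚᵘ-homo-* q (fromℤ (↧ q))) (ℚᵘ.*≡* (ℤ.*-assoc (↥ q) (↧ q) (+ 1))))

  *-cancelˡ-≡0 : ∀ p .{{_ : ℚ.NonZero p}} q → p * q ≡ 0ℚ → q ≡ 0ℚ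
  *-cancelˡ-≡0 p q pq≡0 = begin
    q                ≡⟨ sym (ℚ.*-identityˡ q) ⟩
    1ℚ * q           ≡⟨ cong (_* q) (sym (ℚ.*-inverseˡ p)) ⟩
    (1/ p) * p * q   ≡⟨ ℚ.*-assoc (1/ p) p q ⟩
    (1/ p) * (p * q) ≡⟨ cong ((1/ p) *_) pq≡0 ⟩
    (1/ p) * 0ℚ      ≡⟨ ℚ.*-zeroʳ (1/ p) ⟩
    0ℚ               ∎
    where open ≡-Reasoning

  x≡-x⇒x≡0 : ∀ x → x ≡ - x → x ≡ 0ℚ
  x≡-x⇒x≡0 x x≡-x = *-cancelˡ-≡0 2 x (trans (two-x x) (trans (cong (_+_ x) x≡-x) (ℚ.+-inverseʳ x)))
    where
    two-x : ∀ x → 2 * x ≡ x + x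
    two-x = solve-∀ ℚ-ring

  *-≢0 : ∀ p q → p ≢ 0ℚ → q ≢ 0ℚ → p * q ≢ 0ℚ
  *-≢0 p@record{} q p≢0 q≢0 pq≡0 = q≢0 (*-cancelˡ-≡0 p {{ℤ.≢-nonZero (p≢0 ∘ ℚ.↥p≡0⇒p≡0 p)}} q pq≡0)

  ±1≢0 : ∀ {q} → q ≡ 1 ⊎ q ≡ -1 → q ≢ 0ℚ
  ±1≢0 (inj₁ refl) ()
  ±1≢0 (inj₂ refl) ()

  -1*x≡-x : ∀ x → -1 * x ≡ - x
  -1*x≡-x = solve-∀ ℚ-ring

  isolate-first : ∀ x a b → x + a + b ≡ 0ℚ → x ≡ - (a + b)
  isolate-first x a b eq = inverseˡ-unique x (a + b) (trans (sym (ℚ.+-assoc x a b)) eq)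

  isolate-middle : ∀ a x b → a + x + b ≡ 0ℚ → x ≡ - (a + b)
  isolate-middle a x b eq = inverseˡ-unique x (a + b) (trans (swap a x b) eq)
    where
    swap : ∀ a x b → x + (a + b) ≡ a + x + b
    swap = solve-∀ ℚ-ring

  isolate-last : ∀ a b x → a + b + x ≡ 0ℚ → x ≡ - (a + b)
  isolate-last a b x eq = inverseˡ-unique x (a + b) (trans (ℚ.+-comm x (a + b)) eq)

  -- 2-adic descent
  n<2^n : ∀ n → n ℕ.< 2 ℕ.^ n
  n<2^n zero    = ℕ.s≤s ℕ.z≤n
  n<2^n (suc n) = ℕ.+-mono-≤-< (ℕ.m^n>0 2 n) (ℕ.≤-trans (n<2^n n) (ℕ.m≤m+n (2 ℕ.^ n) 0))

  2^∣a∣∣a⇒a≡0 : ∀ a → + (2 ℕ.^ ∣ a ∣) ℤ.∣ a → a ≡ + 0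
  2^∣a∣∣a⇒a≡0 a 2^∣a∣∣a with ∣ a ∣ in ∣a∣≡
  ... | zero  = ℤ.∣i∣≡0⇒i≡0 ∣a∣≡
  ... | suc m = ⊥-elim (ℕ.<⇒≱ (n<2^n (suc m)) (ℕ.∣⇒≤ (subst (2 ℕ.^ suc m ℕ.∣_) ∣a∣≡ (ℤ.∣⇒∣ᵤ 2^∣a∣∣a))))

  2-adic-descentℤ : ∀ {I : Set} (σ τ : I → I) (b : I → ℤ) z → + 2 ℤ.∣ z →
                    (∀ j → b j ≡ z ℤ.* (b (σ j) ℤ.+ b (τ j))) → ∀ j → b j ≡ + 0
  2-adic-descentℤ σ τ b z 2∣z rec j = 2^∣a∣∣a⇒a≡0 (b j) (2^k∣b ∣ b j ∣ j)
    where
    2^k∣b : ∀ k j → + (2 ℕ.^ k) ℤ.∣ b j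
    2^k∣b zero    j = ℤ.divides (b j) (sym (ℤ.*-identityʳ (b j)))
    2^k∣b (suc k) j = subst₂ ℤ._∣_ (sym (ℤ.pos-* 2 (2 ℕ.^ k))) (sym (rec j))
      (ℤ.∣-trans (ℤ.*-monoˡ-∣ (+ (2 ℕ.^ k)) 2∣z) (ℤ.*-monoʳ-∣ z (ℤ.∣m∣n⇒∣m+n (2^k∣b k (σ j)) (2^k∣b k (τ j)))))

  clear-denominators : ∀ {n} (W : Fin n → ℚ) → Σ ℕ λ m → ∀ j → Σ ℤ λ a → fromℤ (+ suc m) * W j ≡ fromℤ a
  clear-denominators {zero}  W = 0 , λ ()
  clear-denominators {suc n} W with clear-denominators (W ∘ suc)
  ... | m , clear = m ℕ.+ ℚ.denominator-1 (W zero) ℕ.* suc m , clear′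
    where
    open ≡-Reasoning
    q = W zero
    M = fromℤ (+ suc m)
    scale : fromℤ (+ (ℚ.denominatorℕ q ℕ.* suc m)) ≡ fromℤ (↧ q) * M
    scale = trans (cong fromℤ (ℤ.pos-* (ℚ.denominatorℕ q) (suc m))) (fromℤ-* (↧ q) (+ suc m))
    clear′ : ∀ j → Σ ℤ λ a → fromℤ (+ (ℚ.denominatorℕ q ℕ.* suc m)) * W j ≡ fromℤ a
    clear′ zero = ↥ q ℤ.* + suc m , (begin
      fromℤ (+ (ℚ.denominatorℕ q ℕ.* suc m)) * q ≡⟨ cong (_* q) scale ⟩
      fromℤ (↧ q) * M * q                         ≡⟨ reorder (fromℤ (↧ q)) M q ⟩
      q * fromℤ (↧ q) * M                         ≡⟨ cong (_* M) (*-↧≡↥ q) ⟩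
      fromℤ (↥ q) * M                             ≡⟨ sym (fromℤ-* (↥ q) (+ suc m)) ⟩
      fromℤ (↥ q ℤ.* + suc m)                     ∎)
      where
      reorder : ∀ x y z → x * y * z ≡ z * x * y
      reorder = solve-∀ ℚ-ring
    clear′ (suc j) with clear j
    ... | a , Mw≡a = ↧ q ℤ.* a , (begin
      fromℤ (+ (ℚ.denominatorℕ q ℕ.* suc m)) * W (suc j) ≡⟨ cong (_* W (suc j)) scale ⟩
      fromℤ (↧ q) * M * W (suc j)                         ≡⟨ ℚ.*-assoc (fromℤ (↧ q)) M (W (suc j)) ⟩
      fromℤ (↧ q) * (M * W (suc j))                       ≡⟨ cong (fromℤ (↧ q) *_) Mw≡a ⟩
      fromℤ (↧ q) * fromℤ a                               ≡⟨ sym (fromℤ-* (↧ q) a) ⟩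
      fromℤ (↧ q ℤ.* a)                                   ∎)

  2-adic-descent : ∀ {n} (σ τ : Fin n → Fin n) (W : Fin n → ℚ) z → + 2 ℤ.∣ z →
                   (∀ j → W j ≡ fromℤ z * (W (σ j) + W (τ j))) → ∀ j → W j ≡ 0ℚ
  2-adic-descent σ τ W z 2∣z rec j =
    *-cancelˡ-≡0 M (W j) (trans (Mw≡b j) (cong fromℤ (2-adic-descentℤ σ τ b z 2∣z recℤ j)))
    where
    open ≡-Reasoning
    m = proj₁ (clear-denominators W)
    M = fromℤ (+ suc m)
    b : _ → ℤ
    b j = proj₁ (proj₂ (clear-denominators W) j)
    Mw≡b : ∀ j → M * W j ≡ fromℤ (b j)
    Mw≡b j = proj₂ (proj₂ (clear-denominators W) j)
    recℤ : ∀ j → b j ≡ z ℤ.* (b (σ j) ℤ.+ b (τ j))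
    recℤ j = fromℤ-injective (begin
      fromℤ (b j)                                  ≡⟨ sym (Mw≡b j) ⟩
      M * W j                                      ≡⟨ cong (M *_) (rec j) ⟩
      M * (fromℤ z * (W (σ j) + W (τ j)))          ≡⟨ distribute M (fromℤ z) (W (σ j)) (W (τ j)) ⟩
      fromℤ z * (M * W (σ j) + M * W (τ j))        ≡⟨ cong₂ (λ x y → fromℤ z * (x + y)) (Mw≡b (σ j)) (Mw≡b (τ j)) ⟩
      fromℤ z * (fromℤ (b (σ j)) + fromℤ (b (τ j))) ≡⟨ cong (fromℤ z *_) (sym (fromℤ-+ (b (σ j)) (b (τ j)))) ⟩
      fromℤ z * fromℤ (b (σ j) ℤ.+ b (τ j))         ≡⟨ sym (fromℤ-* z _) ⟩
      fromℤ (z ℤ.* (b (σ j) ℤ.+ b (τ j)))           ∎)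
      where
      distribute : ∀ m z x y → m * (z * (x + y)) ≡ z * (m * x + m * y)
      distribute = solve-∀ ℚ-ring

  sign : ℕ → ℚ
  sign zero    = 1
  sign (suc k) = - sign k

  sign-+ : ∀ a b → sign (a ℕ.+ b) ≡ sign a * sign b
  sign-+ zero    b = sym (ℚ.*-identityˡ (sign b))
  sign-+ (suc a) b = trans (cong -_ (sign-+ a b)) (ℚ.neg-distribˡ-* (sign a) (sign b))

  sign-cases : ∀ k → sign k ≡ 1 ⊎ sign k ≡ -1
  sign-cases zero    = inj₁ refl
  sign-cases (suc k) with sign-cases k
  ... | inj₁ sk≡1  = inj₂ (cong -_ sk≡1)
  ... | inj₂ sk≡-1 = inj₁ (cong -_ sk≡-1)

  sign*sign : ∀ k → sign k * sign k ≡ 1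
  sign*sign k with sign-cases k
  ... | inj₁ sk≡1  = cong (λ s → s * s) sk≡1
  ... | inj₂ sk≡-1 = cong (λ s → s * s) sk≡-1

  sign-double : ∀ k → sign (k ℕ.+ k) ≡ 1
  sign-double k = trans (sign-+ k k) (sign*sign k)

  sign-∸ : ∀ {n s} → sign n ≡ 1 → s ℕ.≤ n → sign (n ℕ.∸ s) ≡ sign s
  sign-∸ {n} {s} sign-n≡1 s≤n = begin
    sign (n ℕ.∸ s)                          ≡⟨ sym (ℚ.*-identityʳ (sign (n ℕ.∸ s))) ⟩
    sign (n ℕ.∸ s) * 1                      ≡⟨ cong (sign (n ℕ.∸ s) *_) (sym (sign*sign s)) ⟩
    sign (n ℕ.∸ s) * (sign s * sign s)      ≡⟨ sym (ℚ.*-assoc (sign (n ℕ.∸ s)) (sign s) (sign s)) ⟩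
    sign (n ℕ.∸ s) * sign s * sign s        ≡⟨ cong (_* sign s) (sym (sign-+ (n ℕ.∸ s) s)) ⟩
    sign (n ℕ.∸ s ℕ.+ s) * sign s           ≡⟨ cong (λ k → sign k * sign s) (ℕ.m∸n+n≡m s≤n) ⟩
    sign n * sign s                         ≡⟨ cong (_* sign s) sign-n≡1 ⟩
    1 * sign s                              ≡⟨ ℚ.*-identityˡ (sign s) ⟩
    sign s                                  ∎
    where open ≡-Reasoning

  sign-*2 : ∀ k → sign (k ℕ.* 2) ≡ 1
  sign-*2 k = trans (cong sign (trans (ℕ.*-comm k 2) (cong (k ℕ.+_) (ℕ.+-identityʳ k)))) (sign-double k)

  IsArithmetic : (ℕ → ℚ) → Set
  IsArithmetic G = ∀ k → G (suc (suc k)) + G k ≡ 2 * G (suc k)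

  IsAlternating : (ℕ → ℚ) → Set
  IsAlternating G = ∀ k → G (suc (suc k)) + G k + 2 * G (suc k) ≡ 0ℚ

  fromℤ-suc : ∀ k → fromℤ (+ suc k) ≡ 1 + fromℤ (+ k)
  fromℤ-suc k = fromℤ-+ (+ 1) (+ k)

  arithmetic-closed-form : ∀ G → IsArithmetic G → ∀ k → G k ≡ G 0 + fromℤ (+ k) * (G 1 - G 0)
  arithmetic-closed-form G ap k = proj₁ (consecutive k)
    where
    open ≡-Reasoning
    F : ℕ → ℚ
    F k = G 0 + fromℤ (+ k) * (G 1 - G 0)
    consecutive : ∀ k → G k ≡ F k × G (suc k) ≡ F (suc k)
    consecutive zero    = base₀ (G 0) (G 1) , base₁ (G 0) (G 1)
      where
      base₀ : ∀ a b → a ≡ a + 0 * (b - a)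
      base₀ = solve-∀ ℚ-ring
      base₁ : ∀ a b → b ≡ a + 1 * (b - a)
      base₁ = solve-∀ ℚ-ring
    consecutive (suc k) with consecutive k
    ... | Gk≡Fk , Gk+1≡Fk+1 = Gk+1≡Fk+1 , (begin
      G (2 ℕ.+ k)                                    ≡⟨ add-sub (G (2 ℕ.+ k)) (G k) ⟩
      G (2 ℕ.+ k) + G k - G k                        ≡⟨ cong₂ _-_ (ap k) Gk≡Fk ⟩
      2 * G (1 ℕ.+ k) - F k                          ≡⟨ cong (λ x → 2 * x - F k) Gk+1≡Fk+1 ⟩
      2 * F (1 ℕ.+ k) - F k                          ≡⟨ cong (λ i → 2 * (G 0 + i * Δ) - F k) (fromℤ-suc k) ⟩
      2 * (G 0 + (1 + fromℤ (+ k)) * Δ) - F k         ≡⟨ step (G 0) Δ (fromℤ (+ k)) ⟩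
      G 0 + (1 + (1 + fromℤ (+ k))) * Δ               ≡⟨ cong (λ i → G 0 + (1 + i) * Δ) (sym (fromℤ-suc k)) ⟩
      G 0 + (1 + fromℤ (+ suc k)) * Δ                 ≡⟨ cong (λ i → G 0 + i * Δ) (sym (fromℤ-suc (suc k))) ⟩
      F (2 ℕ.+ k)                                    ∎)
      where
      Δ = G 1 - G 0
      add-sub : ∀ a b → a ≡ a + b - b
      add-sub = solve-∀ ℚ-ring
      step : ∀ a d i → 2 * (a + (1 + i) * d) - (a + i * d) ≡ a + (1 + (1 + i)) * d
      step = solve-∀ ℚ-ring

  periodic-arithmetic⇒constant : ∀ G → IsArithmetic G → ∀ m → G (suc m) ≡ G 0 → ∀ k → G k ≡ G 0
  periodic-arithmetic⇒constant G ap m period k = begin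
    G k                                 ≡⟨ arithmetic-closed-form G ap k ⟩
    G 0 + fromℤ (+ k) * (G 1 - G 0)     ≡⟨ cong (λ d → G 0 + fromℤ (+ k) * d) Δ≡0 ⟩
    G 0 + fromℤ (+ k) * 0ℚ              ≡⟨ cong (_+_ (G 0)) (ℚ.*-zeroʳ (fromℤ (+ k))) ⟩
    G 0 + 0ℚ                            ≡⟨ ℚ.+-identityʳ (G 0) ⟩
    G 0                                 ∎
    where
    open ≡-Reasoning
    Δ≡0 : G 1 - G 0 ≡ 0ℚ
    Δ≡0 = *-cancelˡ-≡0 (fromℤ (+ suc m)) (G 1 - G 0) (begin
      fromℤ (+ suc m) * (G 1 - G 0)                 ≡⟨ sub-add (G 0) _ ⟩
      G 0 + fromℤ (+ suc m) * (G 1 - G 0) - G 0     ≡⟨ cong (_- G 0) (sym (arithmetic-closed-form G ap (suc m))) ⟩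
      G (suc m) - G 0                               ≡⟨ cong (_- G 0) period ⟩
      G 0 - G 0                                     ≡⟨ ℚ.+-inverseʳ (G 0) ⟩
      0ℚ                                            ∎)
      where
      sub-add : ∀ a x → x ≡ a + x - a
      sub-add = solve-∀ ℚ-ring

  alternating⇒sign-arithmetic : ∀ G → IsAlternating G → IsArithmetic (λ k → sign k * G k)
  alternating⇒sign-arithmetic G alt k = begin
    sign (2 ℕ.+ k) * G (2 ℕ.+ k) + sign k * G k           ≡⟨ regroup (sign k) (G (2 ℕ.+ k)) (G k) (G (1 ℕ.+ k)) ⟩
    sign k * (G (2 ℕ.+ k) + G k + 2 * G (1 ℕ.+ k)) + 2 * (sign (1 ℕ.+ k) * G (1 ℕ.+ k))
                                                          ≡⟨ cong (λ x → sign k * x + 2 * (sign (1 ℕ.+ k) * G (1 ℕ.+ k))) (alt k) ⟩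
    sign k * 0ℚ + 2 * (sign (1 ℕ.+ k) * G (1 ℕ.+ k))      ≡⟨ cong (_+ 2 * (sign (1 ℕ.+ k) * G (1 ℕ.+ k))) (ℚ.*-zeroʳ (sign k)) ⟩
    0ℚ + 2 * (sign (1 ℕ.+ k) * G (1 ℕ.+ k))               ≡⟨ ℚ.+-identityˡ _ ⟩
    2 * (sign (1 ℕ.+ k) * G (1 ℕ.+ k))                    ∎
    where
    open ≡-Reasoning
    regroup : ∀ s a b c → (- (- s)) * a + s * b ≡ s * (a + b + 2 * c) + 2 * ((- s) * c)
    regroup = solve-∀ ℚ-ring

  periodic-alternating : ∀ G → IsAlternating G → ∀ m → G (suc m ℕ.+ suc m) ≡ G 0 → ∀ k → G k ≡ sign k * G 0
  periodic-alternating G alt m period k = begin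
    G k                       ≡⟨ sym (ℚ.*-identityˡ (G k)) ⟩
    1 * G k                   ≡⟨ cong (_* G k) (sym (sign*sign k)) ⟩
    sign k * sign k * G k     ≡⟨ ℚ.*-assoc (sign k) (sign k) (G k) ⟩
    sign k * (sign k * G k)   ≡⟨ cong (sign k *_) H-constant ⟩
    sign k * (1 * G 0)        ≡⟨ cong (sign k *_) (ℚ.*-identityˡ (G 0)) ⟩
    sign k * G 0              ∎
    where
    open ≡-Reasoning
    H : ℕ → ℚ
    H k = sign k * G k
    H-period : H (suc m ℕ.+ suc m) ≡ H 0
    H-period = cong₂ _*_ (sign-double (suc m)) period
    H-constant : H k ≡ H 0
    H-constant = periodic-arithmetic⇒constant H (alternating⇒sign-arithmetic G alt) (m ℕ.+ suc m) H-period k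

  indicator : Bool → ℚ
  indicator b = if b then 1ℚ else 0ℚ

  sum-cong : ∀ {n} {f g : Fin n → ℚ} → (∀ i → f i ≡ g i) → sumℚ f ≡ sumℚ g
  sum-cong {zero}  f≗g = refl
  sum-cong {suc n} f≗g = cong₂ _+_ (f≗g zero) (sum-cong (f≗g ∘ suc))

  sum-+ : ∀ {n} (f g : Fin n → ℚ) → sumℚ (λ i → f i + g i) ≡ sumℚ f + sumℚ g
  sum-+ {zero}  f g = refl
  sum-+ {suc n} f g = trans (cong (_+_ (f zero + g zero)) (sum-+ (f ∘ suc) (g ∘ suc)))
                            (interchange (f zero) (g zero) (sumℚ (f ∘ suc)) (sumℚ (g ∘ suc)))
    where
    interchange : ∀ a b c d → a + b + (c + d) ≡ a + c + (b + d)
    interchange = solve-∀ ℚ-ring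

  sum-zero : ∀ {n} (g : Fin n → ℚ) → sumℚ (λ i → 0ℚ * g i) ≡ 0ℚ
  sum-zero {zero}  g = refl
  sum-zero {suc n} g = cong₂ _+_ (ℚ.*-zeroˡ (g zero)) (sum-zero (g ∘ suc))

  sum-++ : ∀ m {k} (f : Fin (m ℕ.+ k) → ℚ) → sumℚ f ≡ sumℚ (λ i → f (i ↑ˡ k)) + sumℚ (λ i → f (m ↑ʳ i))
  sum-++ zero    f = sym (ℚ.+-identityˡ _)
  sum-++ (suc m) f = trans (cong (_+_ (f zero)) (sum-++ m (f ∘ suc))) (sym (ℚ.+-assoc (f zero) _ _))

  sum-combine : ∀ m {k} (f : Fin (m ℕ.* k) → ℚ) → sumℚ f ≡ sumℚ {m} (λ i → sumℚ {k} (λ j → f (combine i j)))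
  sum-combine zero    f = refl
  sum-combine (suc m) {k} f = trans (sum-++ k f) (cong (_+_ (sumℚ (λ j → f (j ↑ˡ (m ℕ.* k))))) (sum-combine m (λ v → f (k ↑ʳ v))))

  sum-indicator : ∀ {n} (b : Fin n → Bool) (k : Fin n) (g : Fin n → ℚ) →
                  b k ≡ true → (∀ j → b j ≡ true → j ≡ k) → sumℚ (λ j → indicator (b j) * g j) ≡ g k
  sum-indicator {suc n} b zero g bk≡true only-k with b zero | bk≡true
  ... | true | _ = trans (cong₂ _+_ (ℚ.*-identityˡ (g zero)) (trans (sum-cong rest≡0) (sum-zero (g ∘ suc)))) (ℚ.+-identityʳ (g zero))
    where
    rest≡0 : ∀ i → indicator (b (suc i)) * g (suc i) ≡ 0ℚ * g (suc i)
    rest≡0 i with b (suc i) in bi≡true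
    ... | true  = ⊥-elim (Fin.0≢1+n (sym (only-k (suc i) bi≡true)))
    ... | false = refl
  sum-indicator {suc n} b (suc k) g bk≡true only-k with b zero in b0≡true
  ... | true  = ⊥-elim (Fin.0≢1+n (only-k zero b0≡true))
  ... | false = trans (cong (_+ sumℚ (λ j → indicator (b (suc j)) * g (suc j))) (ℚ.*-zeroˡ (g zero)))
                  (trans (ℚ.+-identityˡ _) (sum-indicator (b ∘ suc) k (g ∘ suc) bk≡true (λ j bj → Fin.suc-injective (only-k (suc j) bj))))

  indicator-∨ : ∀ x y q → (x ≡ true → y ≡ true → ⊥) → indicator (x ∨ y) * q ≡ indicator x * q + indicator y * q
  indicator-∨ true  true  q disjoint = ⊥-elim (disjoint refl refl)
  indicator-∨ true  false q _ = sym (trans (cong (_+_ (1ℚ * q)) (ℚ.*-zeroˡ q)) (ℚ.+-identityʳ _))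
  indicator-∨ false y     q _ = sym (trans (cong (_+ indicator y * q) (ℚ.*-zeroˡ q)) (ℚ.+-identityˡ _))

  sum-indicator-∨ : ∀ {n} (b c : Fin n → Bool) (g : Fin n → ℚ) → (∀ j → b j ≡ true → c j ≡ true → ⊥) →
                    sumℚ (λ j → indicator (b j ∨ c j) * g j) ≡
                    sumℚ (λ j → indicator (b j) * g j) + sumℚ (λ j → indicator (c j) * g j)
  sum-indicator-∨ b c g disjoint =
    trans (sum-cong (λ j → indicator-∨ (b j) (c j) (g j) (disjoint j))) (sum-+ (λ j → indicator (b j) * g j) (λ j → indicator (c j) * g j))

  -- The cycle ℤ/n
  sameIdx-true : ∀ {m} (j j′ : Fin m) → sameIdx j j′ ≡ true → j′ ≡ j
  sameIdx-true j j′ eq with j Fin.≟ j′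
  ... | yes j≡j′ = sym j≡j′

  sameIdx-refl : ∀ {m} (j : Fin m) → sameIdx j j ≡ true
  sameIdx-refl j with j Fin.≟ j
  ... | yes _   = refl
  ... | no  j≢j = ⊥-elim (j≢j refl)

  half-bounds : ∀ {h n} → h ℕ.+ h ≡ n → 0 ℕ.< n → 0 ℕ.< h × h ℕ.< n
  half-bounds {zero}  refl ()
  half-bounds {suc h} refl _ = ℕ.s≤s ℕ.z≤n , ℕ.m<m+n (suc h) (ℕ.s≤s ℕ.z≤n)

  module ℤ/n (n : ℕ) .{{_ : NonZero n}} where

    shift : ℕ → Fin n → Fin n
    shift s j = (toℕ j ℕ.+ s) mod n

    toℕ-mod : ∀ x → toℕ (x mod n) ≡ x % n
    toℕ-mod x = Fin.toℕ-fromℕ< (m%n<n x n)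

    mod-cong : ∀ {x y} → x % n ≡ y % n → x mod n ≡ y mod n
    mod-cong eq = Fin.toℕ-injective (trans (toℕ-mod _) (trans eq (sym (toℕ-mod _))))

    toℕ-mod-id : ∀ j → toℕ j mod n ≡ j
    toℕ-mod-id j = Fin.toℕ-injective (trans (toℕ-mod _) (m<n⇒m%n≡m (Fin.toℕ<n j)))

    +n-mod : ∀ x → (x ℕ.+ n) mod n ≡ x mod n
    +n-mod x = mod-cong ([m+n]%n≡m%n x n)

    shift-mod : ∀ a x → shift a (x mod n) ≡ (x ℕ.+ a) mod n
    shift-mod a x = mod-cong (begin
      (toℕ (x mod n) ℕ.+ a) % n  ≡⟨ cong (λ t → (t ℕ.+ a) % n) (toℕ-mod x) ⟩
      (x % n ℕ.+ a) % n          ≡⟨ %-distribˡ-+ (x % n) a n ⟩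
      (x % n % n ℕ.+ a % n) % n  ≡⟨ cong (λ t → (t ℕ.+ a % n) % n) (m%n%n≡m%n x n) ⟩
      (x % n ℕ.+ a % n) % n      ≡⟨ %-distribˡ-+ x a n ⟨
      (x ℕ.+ a) % n              ∎)
      where open ≡-Reasoning

    shift-shift : ∀ a b j → shift a (shift b j) ≡ (toℕ j ℕ.+ (b ℕ.+ a)) mod n
    shift-shift a b j = trans (shift-mod a (toℕ j ℕ.+ b)) (cong (_mod n) (ℕ.+-assoc (toℕ j) b a))

    shift-comm : ∀ a b j → shift a (shift b j) ≡ shift b (shift a j)
    shift-comm a b j = trans (shift-shift a b j) (trans (cong (λ c → (toℕ j ℕ.+ c) mod n) (ℕ.+-comm b a)) (sym (shift-shift b a j)))

    shift-inverse : ∀ a b → b ℕ.+ a ≡ n → ∀ j → shift a (shift b j) ≡ j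
    shift-inverse a b b+a≡n j = trans (shift-shift a b j)
      (trans (cong (λ c → (toℕ j ℕ.+ c) mod n) b+a≡n) (trans (+n-mod (toℕ j)) (toℕ-mod-id j)))

    shift-no-fixpoint : ∀ a → 0 ℕ.< a → a ℕ.< n → ∀ j → ¬ shift a j ≡ j
    shift-no-fixpoint a 0<a a<n j fixed = a≢multiple {q} (ℕ.+-cancelˡ-≡ (toℕ j) a (q ℕ.* n) t+a≡t+qn)
      where
      q = (toℕ j ℕ.+ a) / n
      t+a≡t+qn : toℕ j ℕ.+ a ≡ toℕ j ℕ.+ q ℕ.* n
      t+a≡t+qn = trans (m≡m%n+[m/n]*n (toℕ j ℕ.+ a) n) (cong (ℕ._+ q ℕ.* n) (trans (sym (toℕ-mod _)) (cong toℕ fixed)))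
      a≢multiple : ∀ {q} → ¬ a ≡ q ℕ.* n
      a≢multiple {zero}  a≡0    = ℕ.<⇒≢ 0<a (sym a≡0)
      a≢multiple {suc q} a≡qn+n = ℕ.<⇒≱ a<n (ℕ.≤-trans (ℕ.m≤m+n n (q ℕ.* n)) (ℕ.≤-reflexive (sym a≡qn+n)))

    shiftTo-true : ∀ s j j′ → shiftTo n s j j′ ≡ true → j′ ≡ shift s j
    shiftTo-true s j j′ eq with toℕ j′ ℕ.≟ (toℕ j ℕ.+ s) % n
    ... | yes t≡ = Fin.toℕ-injective (trans t≡ (sym (toℕ-mod _)))

    shiftTo-shift : ∀ s j → shiftTo n s j (shift s j) ≡ true
    shiftTo-shift s j with toℕ (shift s j) ℕ.≟ (toℕ j ℕ.+ s) % n
    ... | yes _  = refl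
    ... | no  ≢  = ⊥-elim (≢ (toℕ-mod _))

    shiftTo-irreflexive : ∀ t j → ¬ shift t j ≡ j → shiftTo n t j j ≡ false
    shiftTo-irreflexive t j no-fix with shiftTo n t j j in eq
    ... | true  = ⊥-elim (no-fix (sym (shiftTo-true t j j eq)))
    ... | false = refl

    shifts-distinct : ∀ s → s ℕ.≤ n → 0 ℕ.< s ℕ.+ s → s ℕ.+ s ℕ.< n → ∀ j → ¬ shift s j ≡ shift (n ∸ s) j
    shifts-distinct s s≤n 0<2s 2s<n j eq = shift-no-fixpoint (s ℕ.+ s) 0<2s 2s<n j
      (trans (sym (shift-shift s s j)) (trans (cong (shift s) eq) (shift-inverse s (n ∸ s) (ℕ.m∸n+n≡m s≤n) j)))

    parity : Fin n → ℚ
    parity j = sign (toℕ j)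

    module _ (h : ℕ) (h+h≡n : h ℕ.+ h ≡ n) where

      sign-% : ∀ x → sign (x % n) ≡ sign x
      sign-% x = sym (begin
        sign x                                    ≡⟨ cong sign (m≡m%n+[m/n]*n x n) ⟩
        sign (x % n ℕ.+ x / n ℕ.* n)              ≡⟨ sign-+ (x % n) (x / n ℕ.* n) ⟩
        sign (x % n) * sign (x / n ℕ.* n)          ≡⟨ cong (λ k → sign (x % n) * sign (x / n ℕ.* k)) (sym h+h≡n) ⟩
        sign (x % n) * sign (x / n ℕ.* (h ℕ.+ h))  ≡⟨ cong (λ k → sign (x % n) * sign k) (ℕ.*-distribˡ-+ (x / n) h h) ⟩
        sign (x % n) * sign (x / n ℕ.* h ℕ.+ x / n ℕ.* h) ≡⟨ cong (sign (x % n) *_) (sign-double (x / n ℕ.* h)) ⟩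
        sign (x % n) * 1                           ≡⟨ ℚ.*-identityʳ (sign (x % n)) ⟩
        sign (x % n)                               ∎)
        where open ≡-Reasoning

      parity-shift : ∀ s j → parity (shift s j) ≡ sign s * parity j
      parity-shift s j = begin
        sign (toℕ (shift s j))       ≡⟨ cong sign (toℕ-mod (toℕ j ℕ.+ s)) ⟩
        sign ((toℕ j ℕ.+ s) % n)     ≡⟨ sign-% (toℕ j ℕ.+ s) ⟩
        sign (toℕ j ℕ.+ s)           ≡⟨ sign-+ (toℕ j) s ⟩
        parity j * sign s            ≡⟨ ℚ.*-comm (parity j) (sign s) ⟩
        sign s * parity j            ∎
        where open ≡-Reasoning

    module Orbit (s : ℕ) (s≤n : s ℕ.≤ n) where

      orbit : ℕ → ℕ → Fin n
      orbit r k = (r ℕ.+ k ℕ.* s) mod n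

      shift-orbit⁺ : ∀ r k → shift s (orbit r k) ≡ orbit r (suc k)
      shift-orbit⁺ r k = trans (shift-mod s (r ℕ.+ k ℕ.* s))
        (cong (_mod n) (trans (ℕ.+-assoc r (k ℕ.* s) s) (cong (r ℕ.+_) (ℕ.+-comm (k ℕ.* s) s))))

      shift-orbit⁻ : ∀ r k → shift (n ∸ s) (orbit r (suc k)) ≡ orbit r k
      shift-orbit⁻ r k = trans (shift-mod (n ∸ s) (r ℕ.+ suc k ℕ.* s)) (trans (cong (_mod n) rearrange) (+n-mod (r ℕ.+ k ℕ.* s)))
        where
        open ≡-Reasoning
        rearrange : r ℕ.+ suc k ℕ.* s ℕ.+ (n ∸ s) ≡ r ℕ.+ k ℕ.* s ℕ.+ n
        rearrange = begin
          r ℕ.+ (s ℕ.+ k ℕ.* s) ℕ.+ (n ∸ s)   ≡⟨ cong (λ t → r ℕ.+ t ℕ.+ (n ∸ s)) (ℕ.+-comm s (k ℕ.* s)) ⟩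
          r ℕ.+ (k ℕ.* s ℕ.+ s) ℕ.+ (n ∸ s)   ≡⟨ cong (ℕ._+ (n ∸ s)) (sym (ℕ.+-assoc r (k ℕ.* s) s)) ⟩
          r ℕ.+ k ℕ.* s ℕ.+ s ℕ.+ (n ∸ s)     ≡⟨ ℕ.+-assoc (r ℕ.+ k ℕ.* s) s (n ∸ s) ⟩
          r ℕ.+ k ℕ.* s ℕ.+ (s ℕ.+ (n ∸ s))   ≡⟨ cong (r ℕ.+ k ℕ.* s ℕ.+_) (ℕ.m+[n∸m]≡n s≤n) ⟩
          r ℕ.+ k ℕ.* s ℕ.+ n                 ∎

      orbit-period : ∀ r p q → p ℕ.* s ≡ q ℕ.* n → orbit r p ≡ orbit r 0
      orbit-period r p q ps≡qn = mod-cong (trans (cong (λ t → (r ℕ.+ t) % n) ps≡qn)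
        (trans ([m+kn]%n≡m%n r q n) (cong (_% n) (sym (ℕ.+-identityʳ r)))))

      orbit-arithmetic : ∀ (F : Fin n → ℚ) → (∀ j → F (shift s j) + F (shift (n ∸ s) j) - 2 * F j ≡ 0ℚ) →
                         ∀ r → IsArithmetic (λ k → F (orbit r k))
      orbit-arithmetic F rec r k = x∙y⁻¹≈ε⇒x≈y _ _
        (subst₂ (λ x y → F x + F y - 2 * F (orbit r (suc k)) ≡ 0ℚ) (shift-orbit⁺ r (suc k)) (shift-orbit⁻ r k) (rec (orbit r (suc k))))

      orbit-alternating : ∀ (F : Fin n → ℚ) → (∀ j → F (shift s j) + F (shift (n ∸ s) j) + 2 * F j ≡ 0ℚ) →
                          ∀ r → IsAlternating (λ k → F (orbit r k))
      orbit-alternating F rec r k =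
        subst₂ (λ x y → F x + F y + 2 * F (orbit r (suc k)) ≡ 0ℚ) (shift-orbit⁺ r (suc k)) (shift-orbit⁻ r k) (rec (orbit r (suc k)))

  -- The kernel equations, layer by layer
  pattern 𝐚 = zero
  pattern 𝐛 = suc zero
  pattern 𝐜 = suc (suc zero)
  pattern 𝐝 = suc (suc (suc zero))
  pattern 𝐞 = suc (suc (suc (suc zero)))
  pattern 𝐟 = suc (suc (suc (suc (suc zero))))
  pattern 𝐠 = suc (suc (suc (suc (suc (suc zero)))))

  module ShiftSum {I : Set} (next prev : I → I) where

    shiftSum : (I → ℚ) → I → ℚ
    shiftSum f j = f (next j) + f (prev j)

    shiftSum-cong : ∀ {f g} → (∀ k → f k ≡ g k) → ∀ j → shiftSum f j ≡ shiftSum g j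
    shiftSum-cong f≗g j = cong₂ _+_ (f≗g (next j)) (f≗g (prev j))

    shiftSum-+ : ∀ f g j → shiftSum (λ k → f k + g k) j ≡ shiftSum f j + shiftSum g j
    shiftSum-+ f g j = interchange (f (next j)) (g (next j)) (f (prev j)) (g (prev j))
      where
      interchange : ∀ a b c d → a + b + (c + d) ≡ a + c + (b + d)
      interchange = solve-∀ ℚ-ring

    shiftSum-- : ∀ f g j → shiftSum (λ k → f k - g k) j ≡ shiftSum f j - shiftSum g j
    shiftSum-- f g j = interchange (f (next j)) (g (next j)) (f (prev j)) (g (prev j))
      where
      interchange : ∀ a b c d → a - b + (c - d) ≡ a + c - (b + d)
      interchange = solve-∀ ℚ-ring

    shiftSum+2 : (I → ℚ) → I → ℚ
    shiftSum+2 g j = shiftSum g j + 2 * g j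

    shiftSum-2 : (I → ℚ) → I → ℚ
    shiftSum-2 g j = shiftSum g j - 2 * g j

    -- W = (T + 2)g satisfies (2T − 1)W = (2T² + 3T − 2)g = 0.
    shiftSum+2-eigen : ∀ g j → 2 * shiftSum (shiftSum g) j + 3 * shiftSum g j - 2 * g j ≡ 0ℚ →
                       shiftSum+2 g j ≡ 2 * shiftSum (shiftSum+2 g) j
    shiftSum+2-eigen g j quadratic = begin
      shiftSum+2 g j                                 ≡⟨ identity (shiftSum g (next j)) (shiftSum g (prev j)) (g (next j)) (g (prev j)) (g j) ⟩
      2 * shiftSum (shiftSum+2 g) j - Q              ≡⟨ cong (λ q → 2 * shiftSum (shiftSum+2 g) j - q) quadratic ⟩
      2 * shiftSum (shiftSum+2 g) j - 0ℚ             ≡⟨ ℚ.+-identityʳ _ ⟩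
      2 * shiftSum (shiftSum+2 g) j                  ∎
      where
      open ≡-Reasoning
      Q = 2 * shiftSum (shiftSum g) j + 3 * shiftSum g j - 2 * g j
      identity : ∀ a b c d x → c + d + 2 * x ≡ 2 * (a + 2 * c + (b + 2 * d)) - (2 * (a + b) + 3 * (c + d) - 2 * x)
      identity = solve-∀ ℚ-ring

    -- W = (T − 2)g satisfies (2T + 1)W = (2T² − 3T − 2)g = 0.
    shiftSum-2-eigen : ∀ g j → 2 * shiftSum (shiftSum g) j - 3 * shiftSum g j - 2 * g j ≡ 0ℚ →
                       shiftSum-2 g j ≡ -2 * shiftSum (shiftSum-2 g) j
    shiftSum-2-eigen g j quadratic = begin
      shiftSum-2 g j                                 ≡⟨ identity (shiftSum g (next j)) (shiftSum g (prev j)) (g (next j)) (g (prev j)) (g j) ⟩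
      -2 * shiftSum (shiftSum-2 g) j + Q             ≡⟨ cong (λ q → -2 * shiftSum (shiftSum-2 g) j + q) quadratic ⟩
      -2 * shiftSum (shiftSum-2 g) j + 0ℚ            ≡⟨ ℚ.+-identityʳ _ ⟩
      -2 * shiftSum (shiftSum-2 g) j                 ∎
      where
      open ≡-Reasoning
      Q = 2 * shiftSum (shiftSum g) j - 3 * shiftSum g j - 2 * g j
      identity : ∀ a b c d x → c + d - 2 * x ≡ -2 * (a - 2 * c + (b - 2 * d)) + (2 * (a + b) - 3 * (c + d) - 2 * x)
      identity = solve-∀ ℚ-ring

  module Layers {I : Set} (next prev opp : I → I) where

    open ShiftSum next prev public

    neighbourSum : (Fin 7 → I → ℚ) → Fin 7 → I → ℚ
    neighbourSum Y 𝐚 j = shiftSum (Y 𝐚) j + Y 𝐛 j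
    neighbourSum Y 𝐛 j = Y 𝐚 j + Y 𝐛 (opp j) + Y 𝐜 j
    neighbourSum Y 𝐜 j = Y 𝐛 j + Y 𝐝 j + Y 𝐞 j
    neighbourSum Y 𝐝 j = Y 𝐜 j + Y 𝐝 (opp j) + Y 𝐟 j
    neighbourSum Y 𝐞 j = Y 𝐜 j + Y 𝐞 (opp j) + Y 𝐟 j
    neighbourSum Y 𝐟 j = Y 𝐝 j + Y 𝐞 j + Y 𝐠 j
    neighbourSum Y 𝐠 j = Y 𝐟 j + shiftSum (Y 𝐠) j

    IsLocalKernel : (Fin 7 → I → ℚ) → Set
    IsLocalKernel Y = ∀ L j → neighbourSum Y L j ≡ 0ℚ

    layersFrom : (I → ℚ) → Fin 7 → I → ℚ
    layersFrom D 𝐚 j = 3 * D (opp j) + 2 * shiftSum D j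
    layersFrom D 𝐛 j = -2 * D j
    layersFrom D 𝐜 j = - D (opp j) - 2 * shiftSum D j
    layersFrom D 𝐝 j = D j
    layersFrom D 𝐞 j = D j
    layersFrom D 𝐟 j = 2 * shiftSum D j
    layersFrom D 𝐠 j = -2 * D j

    residual : (I → ℚ) → I → ℚ
    residual D j = 3 * shiftSum (D ∘ opp) j + 2 * shiftSum (shiftSum D) j - 2 * D j

    private
      de-row : ∀ p t → - p - 2 * t + p + 2 * t ≡ 0ℚ
      de-row = solve-∀ ℚ-ring

    a-row : ∀ D j → neighbourSum (layersFrom D) 𝐚 j ≡ residual D j
    a-row D j = identity (D (opp (next j))) (D (opp (prev j))) (shiftSum D (next j)) (shiftSum D (prev j)) (D j)
      where
      identity : ∀ p q u v d → 3 * p + 2 * u + (3 * q + 2 * v) + -2 * d ≡ 3 * (p + q) + 2 * (u + v) - 2 * d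
      identity = solve-∀ ℚ-ring

    layersFrom-kernel : ∀ D → (∀ j → residual D j ≡ 0ℚ) → IsLocalKernel (layersFrom D)
    layersFrom-kernel D res 𝐚 j = trans (a-row D j) (res j)
    layersFrom-kernel D res 𝐛 j = b-row (D (opp j)) (shiftSum D j)
      where
      b-row : ∀ p t → 3 * p + 2 * t + -2 * p + (- p - 2 * t) ≡ 0ℚ
      b-row = solve-∀ ℚ-ring
    layersFrom-kernel D res 𝐜 j = c-row (D j)
      where
      c-row : ∀ d → -2 * d + d + d ≡ 0ℚ
      c-row = solve-∀ ℚ-ring
    layersFrom-kernel D res 𝐝 j = de-row (D (opp j)) (shiftSum D j)
    layersFrom-kernel D res 𝐞 j = de-row (D (opp j)) (shiftSum D j)
    layersFrom-kernel D res 𝐟 j = f-row (D j)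
      where
      f-row : ∀ d → d + d + -2 * d ≡ 0ℚ
      f-row = solve-∀ ℚ-ring
    layersFrom-kernel D res 𝐠 j = g-row (D (next j)) (D (prev j))
      where
      g-row : ∀ u v → 2 * (u + v) + (-2 * u + -2 * v) ≡ 0ℚ
      g-row = solve-∀ ℚ-ring

    layersFrom-scale : ∀ D f c → (∀ j → D j ≡ c * f j) → ∀ L j → layersFrom D L j ≡ c * layersFrom f L j
    layersFrom-scale D f c D≡cf = scaled
      where
      Σ-scaled : ∀ j → shiftSum D j ≡ c * shiftSum f j
      Σ-scaled j = trans (cong₂ _+_ (D≡cf (next j)) (D≡cf (prev j))) (sym (ℚ.*-distribˡ-+ c (f (next j)) (f (prev j))))
      pull : ∀ α c p → α * (c * p) ≡ c * (α * p)
      pull = solve-∀ ℚ-ring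
      pull₂ : ∀ α β c p t → α * (c * p) + β * (c * t) ≡ c * (α * p + β * t)
      pull₂ = solve-∀ ℚ-ring
      pull-neg : ∀ c p t → - (c * p) - 2 * (c * t) ≡ c * (- p - 2 * t)
      pull-neg = solve-∀ ℚ-ring
      scaled : ∀ L j → layersFrom D L j ≡ c * layersFrom f L j
      scaled 𝐚 j = trans (cong₂ (λ p t → 3 * p + 2 * t) (D≡cf (opp j)) (Σ-scaled j)) (pull₂ 3 2 c (f (opp j)) (shiftSum f j))
      scaled 𝐛 j = trans (cong (-2 *_) (D≡cf j)) (pull -2 c (f j))
      scaled 𝐜 j = trans (cong₂ (λ p t → - p - 2 * t) (D≡cf (opp j)) (Σ-scaled j)) (pull-neg c (f (opp j)) (shiftSum f j))
      scaled 𝐝 j = D≡cf j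
      scaled 𝐞 j = D≡cf j
      scaled 𝐟 j = trans (cong (2 *_) (Σ-scaled j)) (pull 2 c (shiftSum f j))
      scaled 𝐠 j = trans (cong (-2 *_) (D≡cf j)) (pull -2 c (f j))

    module KernelLayers (opp-involutive : ∀ j → opp (opp j) ≡ j) (Y : Fin 7 → I → ℚ) (ker : IsLocalKernel Y) where

      D : I → ℚ
      D = Y 𝐝

      e-layer : ∀ j → Y 𝐞 j ≡ D j
      e-layer j = subst (λ k → Y 𝐞 k ≡ D k) (opp-involutive j)
        (trans (isolate-middle (Y 𝐜 (opp j)) (Y 𝐞 (opp (opp j))) (Y 𝐟 (opp j)) (ker 𝐞 (opp j)))
               (sym (isolate-middle (Y 𝐜 (opp j)) (D (opp (opp j))) (Y 𝐟 (opp j)) (ker 𝐝 (opp j)))))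

      private
        neg-double : ∀ d → - (d + d) ≡ -2 * d
        neg-double = solve-∀ ℚ-ring

      b-layer : ∀ j → Y 𝐛 j ≡ -2 * D j
      b-layer j = trans (isolate-first (Y 𝐛 j) (D j) (Y 𝐞 j) (ker 𝐜 j)) (trans (cong (λ e → - (D j + e)) (e-layer j)) (neg-double (D j)))

      g-layer : ∀ j → Y 𝐠 j ≡ -2 * D j
      g-layer j = trans (isolate-last (D j) (Y 𝐞 j) (Y 𝐠 j) (ker 𝐟 j)) (trans (cong (λ e → - (D j + e)) (e-layer j)) (neg-double (D j)))

      f-layer : ∀ j → Y 𝐟 j ≡ 2 * shiftSum D j
      f-layer j = trans (inverseˡ-unique (Y 𝐟 j) (shiftSum (Y 𝐠) j) (ker 𝐠 j))
        (trans (cong₂ (λ u v → - (u + v)) (g-layer (next j)) (g-layer (prev j))) (identity (D (next j)) (D (prev j))))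
        where
        identity : ∀ u v → - (-2 * u + -2 * v) ≡ 2 * (u + v)
        identity = solve-∀ ℚ-ring

      c-layer : ∀ j → Y 𝐜 j ≡ - D (opp j) - 2 * shiftSum D j
      c-layer j = trans (isolate-first (Y 𝐜 j) (D (opp j)) (Y 𝐟 j) (ker 𝐝 j))
        (trans (cong (λ f → - (D (opp j) + f)) (f-layer j)) (identity (D (opp j)) (shiftSum D j)))
        where
        identity : ∀ p t → - (p + 2 * t) ≡ - p - 2 * t
        identity = solve-∀ ℚ-ring

      a-layer : ∀ j → Y 𝐚 j ≡ 3 * D (opp j) + 2 * shiftSum D j
      a-layer j = trans (isolate-first (Y 𝐚 j) (Y 𝐛 (opp j)) (Y 𝐜 j) (ker 𝐛 j))
        (trans (cong₂ (λ b c → - (b + c)) (b-layer (opp j)) (c-layer j)) (identity (D (opp j)) (shiftSum D j)))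
        where
        identity : ∀ p t → - (-2 * p + (- p - 2 * t)) ≡ 3 * p + 2 * t
        identity = solve-∀ ℚ-ring

      layers-determined : ∀ L j → Y L j ≡ layersFrom D L j
      layers-determined 𝐚 = a-layer
      layers-determined 𝐛 = b-layer
      layers-determined 𝐜 = c-layer
      layers-determined 𝐝 j = refl
      layers-determined 𝐞 = e-layer
      layers-determined 𝐟 = f-layer
      layers-determined 𝐠 = g-layer

      residual≡0 : ∀ j → residual D j ≡ 0ℚ
      residual≡0 j = trans (sym (a-row D j))
        (trans (cong₂ _+_ (cong₂ _+_ (sym (a-layer (next j))) (sym (a-layer (prev j)))) (sym (b-layer j))) (ker 𝐚 j))

    module Antipodal (opp-involutive : ∀ j → opp (opp j) ≡ j)
                    (opp-next : ∀ j → opp (next j) ≡ next (opp j)) (opp-prev : ∀ j → opp (prev j) ≡ prev (opp j)) where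

      shiftSum-∘opp : ∀ f j → shiftSum f (opp j) ≡ shiftSum (f ∘ opp) j
      shiftSum-∘opp f j = sym (cong₂ (λ x y → f x + f y) (opp-next j) (opp-prev j))

      even-part odd-part : (I → ℚ) → I → ℚ
      even-part D j = D j + D (opp j)
      odd-part  D j = D j - D (opp j)

      odd-part-∘opp : ∀ D j → odd-part D (opp j) ≡ - odd-part D j
      odd-part-∘opp D j = trans (cong (λ k → D (opp j) - D k) (opp-involutive j)) (identity (D j) (D (opp j)))
        where
        identity : ∀ d p → p - d ≡ - (d - p)
        identity = solve-∀ ℚ-ring

      even+odd : ∀ D j → D j ≡ ½ * (even-part D j + odd-part D j)
      even+odd D j = identity (D j) (D (opp j))
        where
        identity : ∀ d p → d ≡ ½ * (d + p + (d - p))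
        identity = solve-∀ ℚ-ring

      reflected-residual : ∀ D j → residual D (opp j) ≡ 3 * shiftSum D j + 2 * shiftSum (shiftSum (D ∘ opp)) j - 2 * D (opp j)
      reflected-residual D j = cong₂ (λ x y → 3 * x + 2 * y - 2 * D (opp j))
        (trans (shiftSum-∘opp (D ∘ opp) j) (shiftSum-cong (λ k → cong D (opp-involutive k)) j))
        (trans (shiftSum-∘opp (shiftSum D) j) (shiftSum-cong (shiftSum-∘opp D) j))

      module _ (D : I → ℚ) (res : ∀ j → residual D j ≡ 0ℚ) where

        even-quadratic : ∀ j → 2 * shiftSum (shiftSum (even-part D)) j + 3 * shiftSum (even-part D) j - 2 * even-part D j ≡ 0ℚ
        even-quadratic j = begin
          2 * shiftSum (shiftSum (even-part D)) j + 3 * shiftSum (even-part D) j - 2 * even-part D j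
            ≡⟨ cong₂ (λ x y → 2 * x + 3 * y - 2 * even-part D j)
                     (trans (shiftSum-cong (shiftSum-+ D (D ∘ opp)) j) (shiftSum-+ (shiftSum D) (shiftSum (D ∘ opp)) j))
                     (shiftSum-+ D (D ∘ opp) j) ⟩
          2 * (shiftSum (shiftSum D) j + shiftSum (shiftSum (D ∘ opp)) j) + 3 * (shiftSum D j + shiftSum (D ∘ opp) j) - 2 * even-part D j
            ≡⟨ identity (shiftSum (shiftSum D) j) (shiftSum (shiftSum (D ∘ opp)) j) (shiftSum D j) (shiftSum (D ∘ opp) j) (D j) (D (opp j)) ⟩
          residual D j + (3 * shiftSum D j + 2 * shiftSum (shiftSum (D ∘ opp)) j - 2 * D (opp j))
            ≡⟨ cong₂ _+_ (res j) (trans (sym (reflected-residual D j)) (res (opp j))) ⟩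
          0ℚ + 0ℚ
            ≡⟨⟩
          0ℚ ∎
          where
          open ≡-Reasoning
          identity : ∀ u v t w d p → 2 * (u + v) + 3 * (t + w) - 2 * (d + p) ≡ 3 * w + 2 * u - 2 * d + (3 * t + 2 * v - 2 * p)
          identity = solve-∀ ℚ-ring

        odd-quadratic : ∀ j → 2 * shiftSum (shiftSum (odd-part D)) j - 3 * shiftSum (odd-part D) j - 2 * odd-part D j ≡ 0ℚ
        odd-quadratic j = begin
          2 * shiftSum (shiftSum (odd-part D)) j - 3 * shiftSum (odd-part D) j - 2 * odd-part D j
            ≡⟨ cong₂ (λ x y → 2 * x - 3 * y - 2 * odd-part D j)
                     (trans (shiftSum-cong (shiftSum-- D (D ∘ opp)) j) (shiftSum-- (shiftSum D) (shiftSum (D ∘ opp)) j))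
                     (shiftSum-- D (D ∘ opp) j) ⟩
          2 * (shiftSum (shiftSum D) j - shiftSum (shiftSum (D ∘ opp)) j) - 3 * (shiftSum D j - shiftSum (D ∘ opp) j) - 2 * odd-part D j
            ≡⟨ identity (shiftSum (shiftSum D) j) (shiftSum (shiftSum (D ∘ opp)) j) (shiftSum D j) (shiftSum (D ∘ opp) j) (D j) (D (opp j)) ⟩
          residual D j - (3 * shiftSum D j + 2 * shiftSum (shiftSum (D ∘ opp)) j - 2 * D (opp j))
            ≡⟨ cong₂ _-_ (res j) (trans (sym (reflected-residual D j)) (res (opp j))) ⟩
          0ℚ - 0ℚ
            ≡⟨⟩
          0ℚ ∎
          where
          open ≡-Reasoning
          identity : ∀ u v t w d p → 2 * (u - v) - 3 * (t - w) - 2 * (d - p) ≡ 3 * w + 2 * u - 2 * d - (3 * t + 2 * v - 2 * p)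
          identity = solve-∀ ℚ-ring

    module SignVector (σ : I → ℚ) (ε : ℚ) (ε*ε≡1 : ε * ε ≡ 1)
                      (σ-next : ∀ j → σ (next j) ≡ ε * σ j) (σ-prev : ∀ j → σ (prev j) ≡ ε * σ j)
                      (σ-opp : ∀ j → σ (opp j) ≡ - ε * σ j) where

      shiftSum-σ : ∀ j → shiftSum σ j ≡ 2 * ε * σ j
      shiftSum-σ j = trans (cong₂ _+_ (σ-next j) (σ-prev j)) (double ε (σ j))
        where
        double : ∀ e x → e * x + e * x ≡ 2 * e * x
        double = solve-∀ ℚ-ring

      σ-residual : ∀ j → residual σ j ≡ 0ℚ
      σ-residual j = begin
        3 * (σ (opp (next j)) + σ (opp (prev j))) + 2 * (shiftSum σ (next j) + shiftSum σ (prev j)) - 2 * σ j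
          ≡⟨ cong₂ (λ x y → 3 * x + 2 * y - 2 * σ j) (cong₂ _+_ (σ-opp (next j)) (σ-opp (prev j)))
                                                     (cong₂ _+_ (shiftSum-σ (next j)) (shiftSum-σ (prev j))) ⟩
        3 * (- ε * σ (next j) + - ε * σ (prev j)) + 2 * (2 * ε * σ (next j) + 2 * ε * σ (prev j)) - 2 * σ j
          ≡⟨ cong₂ (λ x y → 3 * (- ε * x + - ε * y) + 2 * (2 * ε * x + 2 * ε * y) - 2 * σ j) (σ-next j) (σ-prev j) ⟩
        3 * (- ε * (ε * σ j) + - ε * (ε * σ j)) + 2 * (2 * ε * (ε * σ j) + 2 * ε * (ε * σ j)) - 2 * σ j
          ≡⟨ collect ε (σ j) ⟩
        2 * (ε * ε) * σ j - 2 * σ j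
          ≡⟨ cong (λ e → 2 * e * σ j - 2 * σ j) ε*ε≡1 ⟩
        2 * 1 * σ j - 2 * σ j
          ≡⟨ cancel (σ j) ⟩
        0ℚ ∎
        where
        open ≡-Reasoning
        collect : ∀ e x → 3 * (- e * (e * x) + - e * (e * x)) + 2 * (2 * e * (e * x) + 2 * e * (e * x)) - 2 * x ≡ 2 * (e * e) * x - 2 * x
        collect = solve-∀ ℚ-ring
        cancel : ∀ x → 2 * 1 * x - 2 * x ≡ 0ℚ
        cancel = solve-∀ ℚ-ring

      κ : Fin 7 → ℚ
      κ 𝐚 = ε
      κ 𝐛 = -2
      κ 𝐜 = -3 * ε
      κ 𝐝 = 1
      κ 𝐞 = 1
      κ 𝐟 = 4 * ε
      κ 𝐠 = -2

      layersFrom-σ : ∀ L j → layersFrom σ L j ≡ κ L * σ j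
      layersFrom-σ 𝐚 j = trans (cong₂ (λ p t → 3 * p + 2 * t) (σ-opp j) (shiftSum-σ j)) (identity ε (σ j))
        where
        identity : ∀ e x → 3 * (- e * x) + 2 * (2 * e * x) ≡ e * x
        identity = solve-∀ ℚ-ring
      layersFrom-σ 𝐛 j = refl
      layersFrom-σ 𝐜 j = trans (cong₂ (λ p t → - p - 2 * t) (σ-opp j) (shiftSum-σ j)) (identity ε (σ j))
        where
        identity : ∀ e x → - (- e * x) - 2 * (2 * e * x) ≡ -3 * e * x
        identity = solve-∀ ℚ-ring
      layersFrom-σ 𝐝 j = sym (ℚ.*-identityˡ (σ j))
      layersFrom-σ 𝐞 j = sym (ℚ.*-identityˡ (σ j))
      layersFrom-σ 𝐟 j = trans (cong (2 *_) (shiftSum-σ j)) (identity ε (σ j))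
        where
        identity : ∀ e x → 2 * (2 * e * x) ≡ 4 * e * x
        identity = solve-∀ ℚ-ring
      layersFrom-σ 𝐠 j = refl

      κ≢0 : ε ≡ 1 ⊎ ε ≡ -1 → ∀ L → κ L ≢ 0ℚ
      κ≢0 ε≡±1 𝐚 = ±1≢0 ε≡±1
      κ≢0 ε≡±1 𝐛 = λ ()
      κ≢0 ε≡±1 𝐜 = *-≢0 -3 ε (λ ()) (±1≢0 ε≡±1)
      κ≢0 ε≡±1 𝐝 = λ ()
      κ≢0 ε≡±1 𝐞 = λ ()
      κ≢0 ε≡±1 𝐟 = *-≢0 4 ε (λ ()) (±1≢0 ε≡±1)
      κ≢0 ε≡±1 𝐠 = λ ()

-- The graph G⁽⁷⁾(n; s, s)
cong₃ : ∀ {A B C D : Set} (f : A → B → C → D) {a a′ b b′ c c′} →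
        a ≡ a′ → b ≡ b′ → c ≡ c′ → f a b c ≡ f a′ b′ c′
cong₃ f refl refl refl = refl

∨-true : ∀ x y → x ∨ y ≡ true → x ≡ true ⊎ y ≡ true
∨-true true  y _  = inj₁ refl
∨-true false y eq = inj₂ eq

module G7Layers (n : ℕ) .{{_ : NonZero n}} (s : ℕ) (s≤n : s ℕ.≤ n) (h+h≡n : n / 2 ℕ.+ n / 2 ≡ n)
                (next≢prev : ∀ j → ¬ ℤ/n.shift n s j ≡ ℤ/n.shift n (n ∸ s) j) where

  open ℤ/n n

  next prev opp : Fin n → Fin n
  next = shift s
  prev = shift (n ∸ s)
  opp = shift (n / 2)

  next-prev : ∀ j → next (prev j) ≡ j
  next-prev = shift-inverse s (n ∸ s) (ℕ.m∸n+n≡m s≤n)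

  prev-next : ∀ j → prev (next j) ≡ j
  prev-next = shift-inverse (n ∸ s) s (ℕ.m+[n∸m]≡n s≤n)

  opp-involutive : ∀ j → opp (opp j) ≡ j
  opp-involutive = shift-inverse (n / 2) (n / 2) h+h≡n

  opp-next : ∀ j → opp (next j) ≡ next (opp j)
  opp-next = shift-comm (n / 2) s

  opp-prev : ∀ j → opp (prev j) ≡ prev (opp j)
  opp-prev = shift-comm (n / 2) (n ∸ s)

  open Layers next prev opp public

  edge : Fin 7 × Fin n → Fin 7 × Fin n → Bool
  edge p q = genEdge n s s p q ∨ genEdge n s s q p

  module _ (g : Fin n → ℚ) (j : Fin n) where

    sum-shift-pair : sumℚ (λ j′ → indicator (shiftTo n s j j′ ∨ shiftTo n s j′ j) * g j′) ≡ shiftSum g j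
    sum-shift-pair = trans (sum-indicator-∨ (shiftTo n s j) (λ j′ → shiftTo n s j′ j) g disjoint)
                           (cong₂ _+_ (sum-indicator _ (next j) g (shiftTo-shift s j) (shiftTo-true s j))
                                      (sum-indicator _ (prev j) g to-prev only-prev))
      where
      only-prev : ∀ j′ → shiftTo n s j′ j ≡ true → j′ ≡ prev j
      only-prev j′ eq = trans (sym (prev-next j′)) (cong prev (sym (shiftTo-true s j′ j eq)))
      to-prev : shiftTo n s (prev j) j ≡ true
      to-prev = subst (λ k → shiftTo n s (prev j) k ≡ true) (next-prev j) (shiftTo-shift s (prev j))
      disjoint : ∀ j′ → shiftTo n s j j′ ≡ true → shiftTo n s j′ j ≡ true → ⊥
      disjoint j′ j→j′ j′→j = next≢prev j (trans (sym (shiftTo-true s j j′ j→j′)) (only-prev j′ j′→j))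

    sum-antipode : sumℚ (λ j′ → indicator (shiftTo n (n / 2) j j′ ∨ shiftTo n (n / 2) j′ j) * g j′) ≡ g (opp j)
    sum-antipode = sum-indicator _ (opp j) g (cong (_∨ shiftTo n (n / 2) (opp j) j) (shiftTo-shift (n / 2) j)) only-opp
      where
      only-opp : ∀ j′ → shiftTo n (n / 2) j j′ ∨ shiftTo n (n / 2) j′ j ≡ true → j′ ≡ opp j
      only-opp j′ eq with ∨-true _ _ eq
      ... | inj₁ j→j′ = shiftTo-true (n / 2) j j′ j→j′
      ... | inj₂ j′→j = trans (sym (opp-involutive j′)) (cong opp (sym (shiftTo-true (n / 2) j′ j j′→j)))

    sum-same-index : sumℚ (λ j′ → indicator (sameIdx j j′ ∨ false) * g j′) ≡ g j
    sum-same-index = sum-indicator _ j g (cong (_∨ false) (sameIdx-refl j)) only-j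
      where
      only-j : ∀ j′ → sameIdx j j′ ∨ false ≡ true → j′ ≡ j
      only-j j′ eq with ∨-true _ _ eq
      ... | inj₁ same = sameIdx-true j j′ same

    sum-same-index′ : sumℚ (λ j′ → indicator (false ∨ sameIdx j′ j) * g j′) ≡ g j
    sum-same-index′ = sum-indicator _ j g (sameIdx-refl j) (λ j′ eq → sym (sameIdx-true j′ j eq))

  rowSum : (Fin 7 → Fin n → ℚ) → Fin 7 → Fin n → ℚ
  rowSum X L j = sumℚ {7} (λ L′ → sumℚ {n} (λ j′ → indicator (edge (L , j) (L′ , j′)) * X L′ j′))

  private
    row₇ : ∀ {a₀ a₁ a₂ a₃ a₄ a₅ a₆ b₀ b₁ b₂ b₃ b₄ b₅ b₆ : ℚ} →
           a₀ ≡ b₀ → a₁ ≡ b₁ → a₂ ≡ b₂ → a₃ ≡ b₃ → a₄ ≡ b₄ → a₅ ≡ b₅ → a₆ ≡ b₆ →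
           a₀ + (a₁ + (a₂ + (a₃ + (a₄ + (a₅ + (a₆ + 0ℚ)))))) ≡ b₀ + (b₁ + (b₂ + (b₃ + (b₄ + (b₅ + (b₆ + 0ℚ))))))
    row₇ refl refl refl refl refl refl refl = refl

  rowSum≡neighbourSum : ∀ X L j → rowSum X L j ≡ neighbourSum X L j
  rowSum≡neighbourSum X 𝐚 j =
    trans (row₇ (sum-shift-pair (X 𝐚) j) (sum-same-index (X 𝐛) j) (∅ 𝐜) (∅ 𝐝) (∅ 𝐞) (∅ 𝐟) (∅ 𝐠))
          (tidy (shiftSum (X 𝐚) j) (X 𝐛 j))
    where
    ∅ = λ L → sum-zero (X L)
    tidy : ∀ a b → a + (b + (0ℚ + (0ℚ + (0ℚ + (0ℚ + (0ℚ + 0ℚ)))))) ≡ a + b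
    tidy = solve-∀ ℚ-ring
  rowSum≡neighbourSum X 𝐛 j =
    trans (row₇ (sum-same-index′ (X 𝐚) j) (sum-antipode (X 𝐛) j) (sum-same-index (X 𝐜) j) (∅ 𝐝) (∅ 𝐞) (∅ 𝐟) (∅ 𝐠))
          (tidy (X 𝐚 j) (X 𝐛 (opp j)) (X 𝐜 j))
    where
    ∅ = λ L → sum-zero (X L)
    tidy : ∀ a b c → a + (b + (c + (0ℚ + (0ℚ + (0ℚ + (0ℚ + 0ℚ)))))) ≡ a + b + c
    tidy = solve-∀ ℚ-ring
  rowSum≡neighbourSum X 𝐜 j =
    trans (row₇ (∅ 𝐚) (sum-same-index′ (X 𝐛) j) (∅ 𝐜) (sum-same-index (X 𝐝) j) (sum-same-index (X 𝐞) j) (∅ 𝐟) (∅ 𝐠))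
          (tidy (X 𝐛 j) (X 𝐝 j) (X 𝐞 j))
    where
    ∅ = λ L → sum-zero (X L)
    tidy : ∀ a b c → 0ℚ + (a + (0ℚ + (b + (c + (0ℚ + (0ℚ + 0ℚ)))))) ≡ a + b + c
    tidy = solve-∀ ℚ-ring
  rowSum≡neighbourSum X 𝐝 j =
    trans (row₇ (∅ 𝐚) (∅ 𝐛) (sum-same-index′ (X 𝐜) j) (sum-antipode (X 𝐝) j) (∅ 𝐞) (sum-same-index (X 𝐟) j) (∅ 𝐠))
          (tidy (X 𝐜 j) (X 𝐝 (opp j)) (X 𝐟 j))
    where
    ∅ = λ L → sum-zero (X L)
    tidy : ∀ a b c → 0ℚ + (0ℚ + (a + (b + (0ℚ + (c + (0ℚ + 0ℚ)))))) ≡ a + b + c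
    tidy = solve-∀ ℚ-ring
  rowSum≡neighbourSum X 𝐞 j =
    trans (row₇ (∅ 𝐚) (∅ 𝐛) (sum-same-index′ (X 𝐜) j) (∅ 𝐝) (sum-antipode (X 𝐞) j) (sum-same-index (X 𝐟) j) (∅ 𝐠))
          (tidy (X 𝐜 j) (X 𝐞 (opp j)) (X 𝐟 j))
    where
    ∅ = λ L → sum-zero (X L)
    tidy : ∀ a b c → 0ℚ + (0ℚ + (a + (0ℚ + (b + (c + (0ℚ + 0ℚ)))))) ≡ a + b + c
    tidy = solve-∀ ℚ-ring
  rowSum≡neighbourSum X 𝐟 j =
    trans (row₇ (∅ 𝐚) (∅ 𝐛) (∅ 𝐜) (sum-same-index′ (X 𝐝) j) (sum-same-index′ (X 𝐞) j) (∅ 𝐟) (sum-same-index (X 𝐠) j))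
          (tidy (X 𝐝 j) (X 𝐞 j) (X 𝐠 j))
    where
    ∅ = λ L → sum-zero (X L)
    tidy : ∀ a b c → 0ℚ + (0ℚ + (0ℚ + (a + (b + (0ℚ + (c + 0ℚ)))))) ≡ a + b + c
    tidy = solve-∀ ℚ-ring
  rowSum≡neighbourSum X 𝐠 j =
    trans (row₇ (∅ 𝐚) (∅ 𝐛) (∅ 𝐜) (∅ 𝐝) (∅ 𝐞) (sum-same-index′ (X 𝐟) j) (sum-shift-pair (X 𝐠) j))
          (tidy (X 𝐟 j) (shiftSum (X 𝐠) j))
    where
    ∅ = λ L → sum-zero (X L)
    tidy : ∀ a b → 0ℚ + (0ℚ + (0ℚ + (0ℚ + (0ℚ + (a + (b + 0ℚ)))))) ≡ a + b
    tidy = solve-∀ ℚ-ring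

  G : Graph
  G = G7 n s s

  layered : (Fin (7 ℕ.* n) → ℚ) → Fin 7 → Fin n → ℚ
  layered x L j = x (combine L j)

  unlayered : (Fin 7 → Fin n → ℚ) → Fin (7 ℕ.* n) → ℚ
  unlayered Y v = uncurry Y (remQuot {7} n v)

  adjacency-row : ∀ (x : Fin (7 ℕ.* n) → ℚ) (Y : Fin 7 → Fin n → ℚ) → (∀ L j → x (combine L j) ≡ Y L j) →
                  ∀ L j → sumℚ (λ v → adjMatrix G (combine L j) v * x v) ≡ rowSum Y L j
  adjacency-row x Y x≗Y L j = trans (sum-combine 7 {n} (λ v → adjMatrix G (combine L j) v * x v)) (sum-cong (λ L′ → sum-cong (entry L′)))
    where
    entry : ∀ L′ j′ → adjMatrix G (combine L j) (combine L′ j′) * x (combine L′ j′) ≡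
                      indicator (edge (L , j) (L′ , j′)) * Y L′ j′
    entry L′ j′ = cong₃ (λ p q y → indicator (edge p q) * y) (Fin.remQuot-combine L j) (Fin.remQuot-combine L′ j′) (x≗Y L′ j′)

  null⇒kernel : ∀ x → InNullSpace G x → IsLocalKernel (layered x)
  null⇒kernel x null L j = trans (sym (rowSum≡neighbourSum (layered x) L j))
    (trans (sym (adjacency-row x (layered x) (λ _ _ → refl) L j)) (null (combine L j)))

  kernel⇒null : ∀ Y → IsLocalKernel Y → InNullSpace G (unlayered Y)
  kernel⇒null Y ker u = subst (λ u → sumℚ (λ v → adjMatrix G u v * unlayered Y v) ≡ 0ℚ) (Fin.combine-remQuot {7} n u)
    (trans (adjacency-row (unlayered Y) Y (λ L j → cong (uncurry Y) (Fin.remQuot-combine L j)) L j)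
           (trans (rowSum≡neighbourSum Y L j) (ker L j)))
    where
    L = proj₁ (remQuot {7} n u)
    j = proj₂ (remQuot {7} n u)

  module _ (next-no-fixpoint : ∀ j → ¬ next j ≡ j) (opp-no-fixpoint : ∀ j → ¬ opp j ≡ j) where

    genEdge-irreflexive : ∀ L j → genEdge n s s (L , j) (L , j) ≡ false
    genEdge-irreflexive 𝐚 j = shiftTo-irreflexive s j (next-no-fixpoint j)
    genEdge-irreflexive 𝐛 j = shiftTo-irreflexive (n / 2) j (opp-no-fixpoint j)
    genEdge-irreflexive 𝐜 j = refl
    genEdge-irreflexive 𝐝 j = shiftTo-irreflexive (n / 2) j (opp-no-fixpoint j)
    genEdge-irreflexive 𝐞 j = shiftTo-irreflexive (n / 2) j (opp-no-fixpoint j)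
    genEdge-irreflexive 𝐟 j = refl
    genEdge-irreflexive 𝐠 j = shiftTo-irreflexive s j (next-no-fixpoint j)

    G-simple : IsSimple G
    G-simple = (λ u v → ∨-comm (genEdge n s s (remQuot {7} n u) (remQuot {7} n v)) _)
             , (λ u → cong (λ b → b ∨ b) (genEdge-irreflexive (proj₁ (remQuot {7} n u)) (proj₂ (remQuot {7} n u))))

  open Antipodal opp-involutive opp-next opp-prev public

  module _ (D : Fin n → ℚ) (res : ∀ j → residual D j ≡ 0ℚ) where

    even-part-alternating : ∀ j → shiftSum+2 (even-part D) j ≡ 0ℚ
    even-part-alternating = 2-adic-descent next prev (shiftSum+2 (even-part D)) (+ 2) (ℤ.divides (+ 1) refl)
      (λ j → shiftSum+2-eigen (even-part D) j (even-quadratic D res j))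

    odd-part-arithmetic : ∀ j → shiftSum-2 (odd-part D) j ≡ 0ℚ
    odd-part-arithmetic = 2-adic-descent next prev (shiftSum-2 (odd-part D)) -[1+ 1 ] (ℤ.divides -[1+ 0 ] refl)
      (λ j → shiftSum-2-eigen (odd-part D) j (odd-quadratic D res j))

  ParitySpans : Set
  ParitySpans = ∀ D → (∀ j → shiftSum+2 (even-part D) j ≡ 0ℚ) → (∀ j → shiftSum-2 (odd-part D) j ≡ 0ℚ) →
                ∃ λ c → ∀ j → D j ≡ c * parity j

  parity-vector : Fin (7 ℕ.* n) → ℚ
  parity-vector = unlayered (layersFrom parity)

  kernel-spanned : ParitySpans → ∀ y → InNullSpace G y → ∃ λ c → ∀ u → y u ≡ c * parity-vector u
  kernel-spanned spans y y-null = c , λ u → trans (cong y (sym (Fin.combine-remQuot {7} n u)))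
    (trans (layers-determined (proj₁ (remQuot {7} n u)) (proj₂ (remQuot {7} n u)))
           (layersFrom-scale D parity c D≡c·parity (proj₁ (remQuot {7} n u)) (proj₂ (remQuot {7} n u))))
    where
    open KernelLayers opp-involutive (layered y) (null⇒kernel y y-null)
    c = proj₁ (spans D (even-part-alternating D residual≡0) (odd-part-arithmetic D residual≡0))
    D≡c·parity = proj₂ (spans D (even-part-alternating D residual≡0) (odd-part-arithmetic D residual≡0))

  module _ (antipodal-sign : sign (n / 2) ≡ ℚ.- sign s) where

    private
      sign-n≡1 : sign n ≡ 1ℚ
      sign-n≡1 = subst (λ k → sign k ≡ 1ℚ) h+h≡n (sign-double (n / 2))
      parity-prev : ∀ j → parity (prev j) ≡ sign s * parity j
      parity-prev j = trans (parity-shift (n / 2) h+h≡n (n ∸ s) j) (cong (_* parity j) (sign-∸ sign-n≡1 s≤n))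
      parity-opp : ∀ j → parity (opp j) ≡ ℚ.- sign s * parity j
      parity-opp j = trans (parity-shift (n / 2) h+h≡n (n / 2) j) (cong (_* parity j) antipodal-sign)
      open SignVector parity (sign s) (sign*sign s) (parity-shift (n / 2) h+h≡n s) parity-prev parity-opp

    parity-vector-null : InNullSpace G parity-vector
    parity-vector-null = kernel⇒null (layersFrom parity) (layersFrom-kernel parity σ-residual)

    parity-vector-nonzero : ∀ u → ¬ parity-vector u ≡ 0ℚ
    parity-vector-nonzero u = subst (λ q → ¬ q ≡ 0ℚ) (sym (layersFrom-σ L j))
      (*-≢0 (κ L) (parity j) (κ≢0 (sign-cases s) L) (±1≢0 (sign-cases (Fin.toℕ j))))
      where
      L = proj₁ (remQuot {7} n u)
      j = proj₂ (remQuot {7} n u)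

  nut-criterion : (∀ j → ¬ next j ≡ j) → (∀ j → ¬ opp j ≡ j) → 2 ℕ.≤ 7 ℕ.* n → sign (n / 2) ≡ ℚ.- sign s →
                  ParitySpans → IsNutGraph G
  nut-criterion next-no-fixpoint opp-no-fixpoint 2≤7n antipodal-sign spans =
    G-simple next-no-fixpoint opp-no-fixpoint , 2≤7n , parity-vector ,
    parity-vector-null antipodal-sign , parity-vector-nonzero antipodal-sign , kernel-spanned spans

  halves : ∀ D a → (∀ j → even-part D j + odd-part D j ≡ a * parity j) → ∀ j → D j ≡ (½ * a) * parity j
  halves D a sum j = trans (even+odd D j) (trans (cong (½ *_) (sum j)) (sym (ℚ.*-assoc ½ a (parity j))))

-- The two cases of the theorem
module CaseI (n : ℕ) .{{_ : NonZero n}} (q : ℕ) (n≡q*4 : n ≡ q ℕ.* 4) (4≤n : 4 ℕ.≤ n) where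

  n/2≡q*2 : n / 2 ≡ q ℕ.* 2
  n/2≡q*2 = trans (cong (_/ 2) (trans n≡q*4 (sym (ℕ.*-assoc q 2 2)))) (m*n/n≡m (q ℕ.* 2) 2)

  h+h≡n : n / 2 ℕ.+ n / 2 ≡ n
  h+h≡n = trans (cong₂ ℕ._+_ n/2≡q*2 n/2≡q*2) (trans (sym (ℕ.*-distribˡ-+ q 2 2)) (sym n≡q*4))

  1≤n : 1 ℕ.≤ n
  1≤n = ℕ.≤-trans (s≤s z≤n) 4≤n

  open ℤ/n n
  open Orbit 1 1≤n
  open G7Layers n 1 1≤n h+h≡n (shifts-distinct 1 1≤n (s≤s z≤n) (ℕ.≤-trans (s≤s (s≤s (s≤s z≤n))) 4≤n))

  parity-spans : ParitySpans
  parity-spans D alt ari = ½ * E₀ , halves D E₀ E+O≡E₀·parity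
    where
    E O : Fin n → ℚ
    E = even-part D
    O = odd-part D
    start = orbit 0 0
    E₀ = E start
    orbit-toℕ : ∀ j → orbit 0 (toℕ j) ≡ j
    orbit-toℕ j = trans (cong (_mod n) (ℕ.*-identityʳ (toℕ j))) (toℕ-mod-id j)
    m = ℕ.pred n
    E-alternating : ∀ k → E (orbit 0 k) ≡ sign k * E₀
    E-alternating = periodic-alternating (λ k → E (orbit 0 k)) (orbit-alternating E alt 0) m
      (cong E (orbit-period 0 (suc m ℕ.+ suc m) 2 (trans (ℕ.*-identityʳ (suc m ℕ.+ suc m))
        (trans (cong₂ ℕ._+_ (ℕ.suc-pred n) (ℕ.suc-pred n)) (cong (n ℕ.+_) (sym (ℕ.+-identityʳ n)))))))
    O-constant : ∀ j → O j ≡ O start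
    O-constant j = trans (cong O (sym (orbit-toℕ j)))
      (periodic-arithmetic⇒constant (λ k → O (orbit 0 k)) (orbit-arithmetic O ari 0) m
        (cong O (orbit-period 0 (suc m) 1 (trans (ℕ.*-identityʳ (suc m)) (trans (ℕ.suc-pred n) (sym (ℕ.+-identityʳ n)))))) (toℕ j))
    O≡0 : ∀ j → O j ≡ 0ℚ
    O≡0 j = trans (O-constant j) (x≡-x⇒x≡0 (O start) (trans (sym (O-constant (opp start))) (odd-part-∘opp D start)))
    E+O≡E₀·parity : ∀ j → E j + O j ≡ E₀ * parity j
    E+O≡E₀·parity j = trans (cong₂ _+_ (trans (cong E (sym (orbit-toℕ j))) (E-alternating (toℕ j))) (O≡0 j))
                            (trans (ℚ.+-identityʳ _) (ℚ.*-comm (parity j) E₀))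

  nut : IsNutGraph (G7 n 1 1)
  nut = nut-criterion (shift-no-fixpoint 1 (s≤s z≤n) (ℕ.≤-trans (s≤s (s≤s z≤n)) 4≤n))
                      (shift-no-fixpoint (n / 2) (proj₁ (half-bounds h+h≡n 0<n)) (proj₂ (half-bounds h+h≡n 0<n)))
                      (ℕ.≤-trans (ℕ.≤-trans (s≤s (s≤s z≤n)) 4≤n) (ℕ.m≤m+n n (6 ℕ.* n)))
                      (trans (cong sign n/2≡q*2) (sign-*2 q))
                      parity-spans
    where
    0<n = ℕ.≤-trans (s≤s z≤n) 4≤n

module CaseII (n : ℕ) .{{_ : NonZero n}} (n%4≡2 : n % 4 ≡ 2) (6≤n : 6 ℕ.≤ n) where

  t h : ℕ
  t = n / 4
  h = suc (t ℕ.* 2)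

  n≡h*2 : n ≡ h ℕ.* 2
  n≡h*2 = trans (m≡m%n+[m/n]*n n 4) (cong₂ ℕ._+_ n%4≡2 (sym (ℕ.*-assoc t 2 2)))

  n/2≡h : n / 2 ≡ h
  n/2≡h = trans (cong (_/ 2) n≡h*2) (m*n/n≡m h 2)

  h+h≡n : n / 2 ℕ.+ n / 2 ≡ n
  h+h≡n = trans (cong₂ ℕ._+_ n/2≡h n/2≡h) (trans (cong (h ℕ.+_) (sym (ℕ.+-identityʳ h))) (trans (ℕ.*-comm 2 h) (sym n≡h*2)))

  2≤n : 2 ℕ.≤ n
  2≤n = ℕ.≤-trans (s≤s (s≤s z≤n)) 6≤n

  open ℤ/n n
  open Orbit 2 2≤n
  open G7Layers n 2 2≤n h+h≡n (shifts-distinct 2 2≤n (s≤s z≤n) (ℕ.≤-trans (s≤s (s≤s (s≤s (s≤s (s≤s z≤n))))) 6≤n))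

  sign-h : sign h ≡ ℚ.- 1ℚ
  sign-h = cong ℚ.-_ (sign-*2 t)

  orbit-toℕ : ∀ j → orbit (toℕ j % 2) (toℕ j / 2) ≡ j
  orbit-toℕ j = trans (cong (_mod n) (sym (m≡m%n+[m/n]*n (toℕ j) 2))) (toℕ-mod-id j)

  parity≡sign-%2 : ∀ j → parity j ≡ sign (toℕ j % 2)
  parity≡sign-%2 j = begin
    sign (toℕ j)                                    ≡⟨ cong sign (m≡m%n+[m/n]*n (toℕ j) 2) ⟩
    sign (toℕ j % 2 ℕ.+ toℕ j / 2 ℕ.* 2)            ≡⟨ sign-+ (toℕ j % 2) (toℕ j / 2 ℕ.* 2) ⟩
    sign (toℕ j % 2) * sign (toℕ j / 2 ℕ.* 2)       ≡⟨ cong (sign (toℕ j % 2) *_) (sign-*2 (toℕ j / 2)) ⟩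
    sign (toℕ j % 2) * 1ℚ                           ≡⟨ ℚ.*-identityʳ (sign (toℕ j % 2)) ⟩
    sign (toℕ j % 2)                                ∎
    where open ≡-Reasoning

  half-period : ∀ r → orbit r h ≡ orbit r 0
  half-period r = orbit-period r h 1 (trans (sym n≡h*2) (sym (ℕ.+-identityʳ n)))

  parity-spans : ParitySpans
  parity-spans D alt ari = ½ * O₀ , halves D O₀ E+O≡O₀·parity
    where
    E O : Fin n → ℚ
    E = even-part D
    O = odd-part D
    start = orbit 0 0
    O₀ = O start
    E-alternating : ∀ r k → E (orbit r k) ≡ sign k * E (orbit r 0)
    E-alternating r = periodic-alternating (λ k → E (orbit r k)) (orbit-alternating E alt r) (t ℕ.* 2)
      (cong E (orbit-period r (h ℕ.+ h) 2
        (trans (ℕ.*-distribʳ-+ 2 h h) (cong₂ ℕ._+_ (sym n≡h*2) (trans (sym n≡h*2) (sym (ℕ.+-identityʳ n)))))))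
    E≡0 : ∀ r k → E (orbit r k) ≡ 0ℚ
    E≡0 r k = trans (E-alternating r k) (trans (cong (sign k *_) E₀≡0) (ℚ.*-zeroʳ (sign k)))
      where
      E₀≡0 : E (orbit r 0) ≡ 0ℚ
      E₀≡0 = x≡-x⇒x≡0 _ (trans (cong E (sym (half-period r)))
               (trans (E-alternating r h) (trans (cong (_* E (orbit r 0)) sign-h) (-1*x≡-x (E (orbit r 0))))))
    O-constant : ∀ r k → O (orbit r k) ≡ O (orbit r 0)
    O-constant r = periodic-arithmetic⇒constant (λ k → O (orbit r k)) (orbit-arithmetic O ari r) (t ℕ.* 2) (cong O (half-period r))
    antipode-orbit : orbit 1 t ≡ opp start
    antipode-orbit = trans (cong (_mod n) (sym n/2≡h)) (sym (shift-mod (n / 2) 0))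
    O-orbit : ∀ r → r ℕ.< 2 → O (orbit r 0) ≡ sign r * O₀
    O-orbit zero _ = sym (ℚ.*-identityˡ O₀)
    O-orbit (suc zero) _ = trans (sym (O-constant 1 t)) (trans (cong O antipode-orbit) (trans (odd-part-∘opp D start) (sym (-1*x≡-x O₀))))
    O-orbit (suc (suc r)) (s≤s (s≤s ()))
    E+O≡O₀·parity : ∀ j → E j + O j ≡ O₀ * parity j
    E+O≡O₀·parity j = begin
      E j + O j                                           ≡⟨ cong₂ _+_ (cong E (sym (orbit-toℕ j))) (cong O (sym (orbit-toℕ j))) ⟩
      E (orbit (toℕ j % 2) (toℕ j / 2)) + O (orbit (toℕ j % 2) (toℕ j / 2))
                                                          ≡⟨ cong₂ _+_ (E≡0 (toℕ j % 2) (toℕ j / 2)) (O-constant (toℕ j % 2) (toℕ j / 2)) ⟩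
      0ℚ + O (orbit (toℕ j % 2) 0)                         ≡⟨ ℚ.+-identityˡ _ ⟩
      O (orbit (toℕ j % 2) 0)                              ≡⟨ O-orbit (toℕ j % 2) (m%n<n (toℕ j) 2) ⟩
      sign (toℕ j % 2) * O₀                                ≡⟨ ℚ.*-comm _ O₀ ⟩
      O₀ * sign (toℕ j % 2)                                ≡⟨ cong (O₀ *_) (sym (parity≡sign-%2 j)) ⟩
      O₀ * parity j                                        ∎
      where open ≡-Reasoning

  nut : IsNutGraph (G7 n 2 2)
  nut = nut-criterion (shift-no-fixpoint 2 (s≤s z≤n) (ℕ.≤-trans (s≤s (s≤s (s≤s z≤n))) 6≤n))
                      (shift-no-fixpoint (n / 2) (proj₁ (half-bounds h+h≡n 0<n)) (proj₂ (half-bounds h+h≡n 0<n)))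
                      (ℕ.≤-trans 2≤n (ℕ.m≤m+n n (6 ℕ.* n)))
                      (trans (cong sign n/2≡h) sign-h)
                      parity-spans
    where
    0<n = ℕ.≤-trans (s≤s z≤n) 6≤n

proposition10 : (n : ℕ) .{{_ : NonZero n}} (α β : ℕ) →
    ((4 ≤ n × 4 ∣ n × α ≡ 1 × β ≡ 1) ⊎ (6 ≤ n × n % 4 ≡ 2 × α ≡ 2 × β ≡ 2)) →
    IsNutGraph (G7 n α β)
proposition10 n α β (inj₁ (4≤n , divides q n≡q*4 , refl , refl)) = CaseI.nut n q n≡q*4 4≤n
proposition10 n α β (inj₂ (6≤n , n%4≡2 , refl , refl))          = CaseII.nut n n%4≡2 6≤n
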